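{- Let $G$ be a connected metric graph with $\ell(G)$ leaves, cyclomatic number $\mathrm{cyc}(G)$, total length $\mathrm{len}(G)$ and radius $R=\mathrm{radius}(G)$. Then the equality $$\mathrm{len}(G) = \big(2\,\mathrm{cyc}(G) + \ell(G)\big)\cdot R$$ holds if and only if $G$ consists of a single non-leaf vertex $u$, together with $\ell(G)$ edges of length $R$ each joining $u$ to a distinct leaf, and $\mathrm{cyc}(G)$ loops of length $2R$ incident to $u$.
   Context: A metric graph is the compact metric space obtained from a finite collection of compact intervals (edges) of positive length by identifying their endpoints in groups (the vertices); equivalently, it is a finite edge-weighted multigraph (loops and parallel edges allowed) in which all points in the interior of each edge are included and each edge is locally isometric to an interval whose length is the edge weight. Metric graphs are assumed connected. Vertices of degree two may be inserted by splitting edges, or removed by merging edges, without changing the metric graph; in the description in the claim, $u$ may be such a vertex of degree two. The distance $d_G(x,y)$ is the minimum length of a path in $G$ from $x$ to $y$. The radius is $\mathrm{radius}(G)=\min_{x\in G}\max_{y\in G} d_G(x,y)$, over all points of $G$ (not only vertices). The length $\mathrm{len}(G)$ is the sum of the lengths of the edges. A leaf is a vertex of degree one, and $\ell(G)$ is the number of leaves. The cyclomatic number is $\mathrm{cyc}(G)=|E|-|V|+1$ for any combinatorial graph $(V,E)$ describing $G$. -}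

module Defs where

open import Algebra.Bundles using (CommutativeRing; AbelianGroup)
open import Algebra.Definitions.RawMonoid using () renaming (_×_ to multiple; sum to sumOf)
open import Data.Fin.Base using (Fin; zero; suc)
open import Data.Fin.Properties using () renaming (_≟_ to _≟ᶠ_)
open import Data.List.Base using (length; filter; allFin)
open import Data.Nat.Base as ℕ using (ℕ; suc)
open import Data.Nat.Properties using () renaming (_≟_ to _≟ⁿ_)
open import Data.Product.Base using (Σ-syntax; ∃; _×_)
open import Data.Sum.Base using (_⊎_)
open import Data.Vec.Functional using (Vector; _∷_; _++_; replicate; updateAt)
open import Function.Base using (_∘_; const)
open import Function.Bundles using (_↔_; Inverse)
open import Level using (Level)
open import Relation.Binary.Construct.Closure.Equivalence using (EqClosure)
open import Relation.Binary.Core using (Rel)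
open import Relation.Binary.PropositionalEquality.Core using (_≡_)
open import Relation.Binary.Structures using (IsTotalOrder)
open import Relation.Nullary.Negation.Core using (¬_)
open import Relation.Unary using (Pred)

-- The field of real numbers, given by its usual axioms: a totally ordered field
-- in which every nonempty subset bounded above has a least upper bound.
record RealNumbers (a : Level) : Set (Level.suc a) where
  infix 4 _≤_ _<_
  infixr 8 _·_
  field
    commutativeRing : CommutativeRing a a

  open CommutativeRing commutativeRing public

  field
    0≉1          : ¬ 0# ≈ 1#
    inverse      : ∀ x → ¬ x ≈ 0# → ∃ λ y → x * y ≈ 1#
    _≤_          : Rel Carrier a
    isTotalOrder : IsTotalOrder _≈_ _≤_
    +-monoʳ-≤    : ∀ z {x y} → x ≤ y → z + x ≤ z + y
    *-nonneg     : ∀ {x y} → 0# ≤ x → 0# ≤ y → 0# ≤ x * y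

  _IsUpperBoundOf_ : Carrier → Pred Carrier a → Set a
  b IsUpperBoundOf P = ∀ x → P x → x ≤ b

  field
    complete : (P : Pred Carrier a) → ∃ P → ∃ (_IsUpperBoundOf P) →
               ∃ λ s → s IsUpperBoundOf P × (∀ b → b IsUpperBoundOf P → s ≤ b)

  _<_ : Rel Carrier a
  x < y = x ≤ y × ¬ x ≈ y

  _·_ : ℕ → Carrier → Carrier
  _·_ = multiple (AbelianGroup.rawMonoid +-abelianGroup)

  sum : ∀ {n} → Vector Carrier n → Carrier
  sum = sumOf (AbelianGroup.rawMonoid +-abelianGroup)

  IsMinimumOf : Pred Carrier a → Pred Carrier a
  IsMinimumOf P m = P m × (∀ x → P x → m ≤ x)

  IsMaximumOf : Pred Carrier a → Pred Carrier a
  IsMaximumOf P m = P m × m IsUpperBoundOf P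

module MetricGraphs {a : Level} (ℝ : RealNumbers a) where

  open RealNumbers ℝ hiding (zero) renaming (Carrier to Real)

  -- A finite edge-weighted multigraph, with loops and parallel edges. The
  -- orientation of an edge is only a parametrisation: edge e is the interval
  -- [0, len e] with 0 glued to source e and len e glued to target e.
  record WeightedGraph : Set a where
    field
      vertexCount : ℕ
      edgeCount   : ℕ
      source      : Vector (Fin vertexCount) edgeCount
      target      : Vector (Fin vertexCount) edgeCount
      len         : Vector Real edgeCount

    -- Number of edge ends at v, so a loop counts twice.
    degree : Fin vertexCount → ℕ
    degree v = length (filter (λ e → source e ≟ᶠ v) (allFin edgeCount))
         ℕ.+ length (filter (λ e → target e ≟ᶠ v) (allFin edgeCount))

    IsLeaf : Fin vertexCount → Set
    IsLeaf v = degree v ≡ 1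

    leafCount : ℕ
    leafCount = length (filter (λ v → degree v ≟ⁿ 1) (allFin vertexCount))

    -- |E| - |V| + 1; the subtraction does not truncate on connected graphs.
    cyc : ℕ
    cyc = (edgeCount ℕ.+ 1) ℕ.∸ vertexCount

    totalLength : Real
    totalLength = sum len

    -- Points of the disjoint union of the vertices and the edge intervals. The
    -- gluing is done by atSource and atTarget: glued points are at distance 0.
    data Point : Set a where
      vertex : Fin vertexCount → Point
      on     : (e : Fin edgeCount) (t : Real) → 0# ≤ t → t ≤ len e → Point

    data Joined : Point → Point → Real → Set a where
      along    : ∀ {e s t} 0≤s s≤l 0≤t t≤l → s ≤ t →
                 Joined (on e s 0≤s s≤l) (on e t 0≤t t≤l) (t - s)
      atSource : ∀ {e t} 0≤t t≤l → t ≈ 0# →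
                 Joined (on e t 0≤t t≤l) (vertex (source e)) 0#
      atTarget : ∀ {e t} 0≤t t≤l → t ≈ len e →
                 Joined (on e t 0≤t t≤l) (vertex (target e)) 0#

    -- Concatenations of finitely many segments, each inside one edge.
    data Path : Point → Point → Set a where
      []  : ∀ {x} → Path x x
      _◅_ : ∀ {x y z d} → Joined x y d ⊎ Joined y x d → Path y z → Path x z

    pathLength : ∀ {x y} → Path x y → Real
    pathLength []                = 0#
    pathLength (_◅_ {d = d} _ p) = d + pathLength p

    IsDistance : Point → Point → Real → Set a
    IsDistance x y = IsMinimumOf λ d → Σ[ p ∈ Path x y ] pathLength p ≈ d

    IsEccentricity : Point → Real → Set a
    IsEccentricity x = IsMaximumOf λ d → ∃ λ y → IsDistance x y d

    IsRadius : Real → Set a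
    IsRadius = IsMinimumOf λ r → ∃ λ x → IsEccentricity x r

  record MetricGraph : Set a where
    field
      graph : WeightedGraph

    open WeightedGraph graph public

    field
      len-positive : ∀ e → 0# < len e
      nonempty     : Point
      connected    : ∀ x y → Path x y

  open WeightedGraph

  record _≅_ (G H : WeightedGraph) : Set a where
    field
      onVertices : Fin (vertexCount G) ↔ Fin (vertexCount H)
      onEdges    : Fin (edgeCount G) ↔ Fin (edgeCount H)

    φ = Inverse.to onVertices
    ψ = Inverse.to onEdges

    field
      len-preserved  : ∀ e → len H (ψ e) ≈ len G e
      ends-preserved : ∀ e →
        (source H (ψ e) ≡ φ (source G e) × target H (ψ e) ≡ φ (target G e)) ⊎
        (source H (ψ e) ≡ φ (target G e) × target H (ψ e) ≡ φ (source G e))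

  -- Inserts a vertex, numbered zero, on edge e, cutting it into lengths b and c.
  -- The first part keeps the number of e (shifted by suc); the second part,
  -- from the new vertex to the old target of e, is the new edge zero.
  split : (G : WeightedGraph) → Fin (edgeCount G) → Real → Real → WeightedGraph
  split G e b c = record
    { vertexCount = suc (vertexCount G)
    ; edgeCount   = suc (edgeCount G)
    ; source      = zero ∷ (suc ∘ source G)
    ; target      = suc (target G e) ∷ updateAt (suc ∘ target G) e (const zero)
    ; len         = c ∷ updateAt (len G) e (const b)
    }

  data Step : Rel WeightedGraph a where
    relabel   : ∀ {G H} → G ≅ H → Step G H
    subdivide : ∀ {G} e b c → 0# < b → 0# < c → b + c ≈ len G e →
                Step G (split G e b c)

  -- Two weighted graphs describe the same metric graph when they are related by
  -- inserting and removing vertices of degree two, up to isomorphism.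
  _∼_ : Rel WeightedGraph a
  _∼_ = EqClosure Step

  -- Vertex zero is the centre.
  star : ℕ → ℕ → Real → WeightedGraph
  star leaves loops R = record
    { vertexCount = suc leaves
    ; edgeCount   = leaves ℕ.+ loops
    ; source      = replicate (leaves ℕ.+ loops) zero
    ; target      = suc ++ replicate loops zero
    ; len         = replicate leaves R ++ replicate loops (2 · R)
    }

  IsStar : WeightedGraph → Real → Set a
  IsStar G R = G ∼ S × ¬ IsLeaf S zero
    where S = star (leafCount G) (cyc G) R

-- Let u be a centre and f the distance from u; cutting an edge if necessary, u
-- is a vertex. Every vertex v ≠ u has a parent edge, the last edge of a shortest
-- path from u to v. An edge e with ends v and w contains a point at distance
-- (f v + f w + len e) / 2 from u, so the peak f v + f w + len e is at most 2R; it
-- is 2 f v if e is the parent edge of v. Parent edges of different vertices are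
-- different, so exactly cyc(G) edges are not parent edges. Summing the peaks,
--   len(G) ≤ cyc(G) · 2R + Σᵥ (2 - deg v) · f v ≤ (2 cyc(G) + ℓ(G)) · R.
-- If equality holds, every vertex other than u is either a leaf at distance R or
-- of degree two, and all other peaks are 2R. Removing a vertex of degree two
-- keeps the situation; once there are none left, the parent edges join u to the
-- leaves and the other edges are loops of length 2R at u. The converse holds
-- because subdivision does not change the total length.

module Submission where

open import Algebra.Bundles using (CommutativeMonoid; AbelianGroup)
import Algebra.Properties.AbelianGroup as AbelianGroupProperties
import Algebra.Properties.CommutativeMonoid.Sum as CommutativeMonoidSum
import Algebra.Properties.CommutativeSemigroup as CommutativeSemigroupProperties
import Algebra.Properties.Monoid.Mult as MonoidMult
import Algebra.Properties.Ring as RingProperties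
open import Axiom.ExcludedMiddle using (ExcludedMiddle)
open import Data.Bool.Base using (true; false; if_then_else_)
open import Data.Fin.Base as Fin using (Fin; zero; suc; punchIn; punchOut; _↑ˡ_; splitAt)
open import Data.Fin.Induction using (spo-wellFounded)
open import Data.Fin.Permutation as Perm using (Permutation; _⟨$⟩ˡ_; _⟨$⟩ʳ_)
open import Data.Fin.Properties
  using ( suc-injective; punchInᵢ≢i; punchIn-injective; punchIn-punchOut; punchOut-injective
        ; injective⇒≤; any?; splitAt-↑ˡ; splitAt⁻¹-↑ˡ )
  renaming (_≟_ to _≟ᶠ_)
open import Data.List.Base using (length; filter; tabulate; allFin)
open import Data.Maybe.Base using (Maybe; just; nothing)
open import Data.Nat.Base as ℕ using (ℕ; zero; suc)
import Data.Nat.Properties as ℕₚ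
open import Data.Product.Base using (Σ-syntax; ∃; ∃-syntax; _×_; _,_; proj₁; proj₂)
open import Data.Sum.Base using (_⊎_; inj₁; inj₂; [_,_]; [_,_]′)
open import Data.Unit.Base using (⊤; tt)
open import Data.Vec.Base as Vec using (Vec; []; _∷_)
open import Data.Vec.Functional using (Vector; updateAt; removeAt)
import Data.Vec.Functional.Properties as Vectorₚ
open import Defs
open import Function.Base using (_∘_; const; id)
open import Function.Bundles using (_⇔_; mk⇔)
open import Function.Definitions using (Injective)
open import Induction.WellFounded using (WellFounded; Acc; acc)
open import Level using (Level; Lift; lift)
import Relation.Binary.Construct.Closure.Equivalence as EqClosure
import Relation.Binary.Construct.Closure.ReflexiveTransitive as Star
open import Relation.Binary.Construct.Closure.Symmetric using (fwd; bwd)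
open import Relation.Binary.PropositionalEquality.Core
  using (_≡_; _≢_; refl; sym; trans; cong; cong₂; subst; subst₂)
open import Relation.Binary.PropositionalEquality.Properties using ()
  renaming (isEquivalence to ≡-isEquivalence)
import Relation.Binary.Reasoning.Setoid as SetoidReasoning
import Relation.Binary.Reflection as Reflection
open import Relation.Binary.Structures using (IsTotalOrder)
open import Relation.Nullary.Decidable.Core using (Dec; yes; no; does; decidable-stable; ¬?; _×-dec_)
open import Relation.Nullary.Negation.Core using (¬_; contradiction)
open import Relation.Unary using (Pred; Decidable)

-- Two obstacles shape the proof. Paths between two points form an infinite family, so shortest ones
-- have to be constructed. This is done by duality: distances from the centre are the greatest
-- function satisfying a finite system of difference constraints, which completeness provides. It is
-- tight at every vertex, and tracing tight constraints back to the centre yields a path of the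
-- right length.
--
-- Removing a vertex of degree two would call for comparing the metrics of two graphs. The counting
-- therefore sees only a `Potential`, in which no paths occur. The metric is consulted once, to
-- build a potential at a centre; isomorphisms and mergers then act on potentials directly. If the
-- centre lies inside an edge, distances are still measured in the original graph, and only the
-- resulting heights are read on the split graph.
--
-- The estimates carry natural coefficients on both sides, without subtraction, so that equality of
-- the totals forces equality in every term.

𝟙 : ∀ {p} {P : Set p} → Dec P → ℕ
𝟙 P? = if does P? then 1 else 0

𝟙-yes : ∀ {p} {P : Set p} (P? : Dec P) → P → 𝟙 P? ≡ 1
𝟙-yes (yes _) _ = refl
𝟙-yes (no ¬p) p = contradiction p ¬p

𝟙-no : ∀ {p} {P : Set p} (P? : Dec P) → ¬ P → 𝟙 P? ≡ 0
𝟙-no (yes p) ¬p = contradiction p ¬p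
𝟙-no (no _) _ = refl

𝟙-cong : ∀ {p q} {P : Set p} {Q : Set q} (P? : Dec P) (Q? : Dec Q) →
         (P → Q) → (Q → P) → 𝟙 P? ≡ 𝟙 Q?
𝟙-cong (yes p) Q? to from = sym (𝟙-yes Q? (to p))
𝟙-cong (no ¬p) Q? to from = sym (𝟙-no Q? (¬p ∘ from))

-- Sums and counts over finite index sets.

module ℕ∑ = CommutativeMonoidSum ℕₚ.+-0-commutativeMonoid

length-filter : ∀ {p k} {A : Set} {P : Pred A p} (P? : Decidable P) (f : Fin k → A) →
                length (filter P? (tabulate f)) ≡ ℕ∑.sum (λ i → 𝟙 (P? (f i)))
length-filter {k = zero} P? f = refl
length-filter {k = suc k} P? f with does (P? (f zero))
... | true  = cong suc (length-filter P? (f ∘ suc))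
... | false = length-filter P? (f ∘ suc)

sum≡0⇒ : ∀ {k} (d : Fin k → ℕ) → ℕ∑.sum d ≡ 0 → ∀ i → d i ≡ 0
sum≡0⇒ d eq zero    = ℕₚ.m+n≡0⇒m≡0 (d zero) eq
sum≡0⇒ d eq (suc i) = sum≡0⇒ (d ∘ suc) (ℕₚ.m+n≡0⇒n≡0 (d zero) eq) i

sum-zero : ∀ {k} (d : Fin k → ℕ) → (∀ i → d i ≡ 0) → ℕ∑.sum d ≡ 0
sum-zero {zero}  d eq = refl
sum-zero {suc k} d eq = cong₂ ℕ._+_ (eq zero) (sum-zero (d ∘ suc) (eq ∘ suc))

sum-ones : ∀ {k} (d : Fin k → ℕ) → (∀ i → d i ≡ 1) → ℕ∑.sum d ≡ k
sum-ones {zero}  d eq = refl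
sum-ones {suc k} d eq = cong₂ ℕ._+_ (eq zero) (sum-ones (d ∘ suc) (eq ∘ suc))

sum≢0⇒ : ∀ {k} (d : Fin k → ℕ) → ℕ∑.sum d ≢ 0 → ∃[ i ] d i ≢ 0
sum≢0⇒ {zero} d ≢0 = contradiction refl ≢0
sum≢0⇒ {suc k} d ≢0 with d zero ℕₚ.≟ 0
... | no d₀≢0  = zero , d₀≢0
... | yes d₀≡0 =
  let i , dᵢ≢0 = sum≢0⇒ (d ∘ suc) (λ eq → ≢0 (cong₂ ℕ._+_ d₀≡0 eq)) in suc i , dᵢ≢0

-- Isolates an edge at a vertex: among the edge ends at a leaf only the parent edge remains, and at
-- a vertex of degree two, once the parent edge is set aside, only the second edge.
sum-only : ∀ {k} (d : Fin k → ℕ) → ℕ∑.sum d ≡ 1 → ∀ i → d i ≢ 0 →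
           d i ≡ 1 × (∀ j → j ≢ i → d j ≡ 0)
sum-only {suc k} d eq i dᵢ≢0 = split (d i) refl
  where
  eq′ : d i ℕ.+ ℕ∑.sum (removeAt d i) ≡ 1
  eq′ = trans (sym (ℕ∑.sum-remove {i = i} d)) eq
  split : ∀ x → d i ≡ x → d i ≡ 1 × (∀ j → j ≢ i → d j ≡ 0)
  split zero dᵢ≡0 = contradiction dᵢ≡0 dᵢ≢0
  split (suc x) dᵢ≡1+x =
      trans dᵢ≡1+x (cong suc (ℕₚ.m+n≡0⇒m≡0 x rest))
    , λ j j≢i → trans (cong d (sym (punchIn-punchOut (j≢i ∘ sym))))
                      (sum≡0⇒ (removeAt d i) (ℕₚ.m+n≡0⇒n≡0 x rest) _)
    where
    rest : x ℕ.+ ℕ∑.sum (removeAt d i) ≡ 0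
    rest = ℕₚ.suc-injective (trans (cong (ℕ._+ ℕ∑.sum (removeAt d i)) (sym dᵢ≡1+x)) eq′)

count : ∀ {k m} → (Fin k → Fin m) → Fin m → ℕ
count {k} p j = length (filter (λ i → p i ≟ᶠ j) (allFin k))

count≡sum : ∀ {k m} (p : Fin k → Fin m) j → count p j ≡ ℕ∑.sum (λ i → 𝟙 (p i ≟ᶠ j))
count≡sum p j = length-filter (λ i → p i ≟ᶠ j) id

count-∉ : ∀ {k m} (p : Fin k → Fin m) j → (∀ i → p i ≢ j) → count p j ≡ 0
count-∉ p j ∉ = trans (count≡sum p j) (sum-zero _ λ i → 𝟙-no (p i ≟ᶠ j) (∉ i))

module FiniteSums {c ℓ} (M : CommutativeMonoid c ℓ) where

  open CommutativeMonoid M using (Carrier; _≈_; setoid; monoid) renaming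
    ( _∙_ to _+_; ε to 0#; ∙-cong to +-cong; ∙-congˡ to +-congˡ; ∙-congʳ to +-congʳ
    ; identityˡ to +-identityˡ; identityʳ to +-identityʳ; assoc to +-assoc; comm to +-comm
    ; refl to ≈-refl; sym to ≈-sym; trans to ≈-trans )
  open CommutativeMonoidSum M public
  open MonoidMult monoid using (×-homo-+; ×-congˡ) renaming (_×_ to _·_)
  open SetoidReasoning setoid

  sum-· : ∀ {k} (n : Fin k → ℕ) x → sum (λ i → n i · x) ≈ ℕ∑.sum n · x
  sum-· {zero}  n x = ≈-refl
  sum-· {suc k} n x = ≈-trans (+-congˡ (sum-· (n ∘ suc) x)) (≈-sym (×-homo-+ x (n zero) _))

  sum-𝟙 : ∀ {m} (w : Fin m → Carrier) j → sum (λ e → 𝟙 (j ≟ᶠ e) · w e) ≈ w j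
  sum-𝟙 {suc m} w zero = begin
    (w zero + 0#) + sum {m} (λ e → 0#) ≈⟨ +-congˡ (sum-replicate-zero m) ⟩
    (w zero + 0#) + 0#                 ≈⟨ +-identityʳ _ ⟩
    w zero + 0#                        ≈⟨ +-identityʳ _ ⟩
    w zero                             ∎
  sum-𝟙 {suc m} w (suc j) = ≈-trans (+-identityˡ _) (sum-𝟙 (w ∘ suc) j)

  -- Double counting: each `w (p i)` is written as an indicator sum, and the two sums are exchanged.
  -- It relates sums over edge ends to sums over vertices weighted by degree, and sums over parent
  -- edges to sums over edges weighted by `parentCount`.
  sum-fibres : ∀ {k m} (p : Fin k → Fin m) (w : Fin m → Carrier) →
               sum (w ∘ p) ≈ sum (λ e → count p e · w e)
  sum-fibres p w = begin
    sum (w ∘ p)                                       ≈⟨ sum-cong-≋ (λ i → sum-𝟙 w (p i)) ⟨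
    sum (λ i → sum (λ e → 𝟙 (p i ≟ᶠ e) · w e))        ≈⟨ ∑-comm (λ i e → 𝟙 (p i ≟ᶠ e) · w e) ⟩
    sum (λ e → sum (λ i → 𝟙 (p i ≟ᶠ e) · w e))        ≈⟨ sum-cong-≋ (λ e → sum-· (λ i → 𝟙 (p i ≟ᶠ e)) (w e)) ⟩
    sum (λ e → ℕ∑.sum (λ i → 𝟙 (p i ≟ᶠ e)) · w e)     ≈⟨ sum-cong-≋ (λ e → ×-congˡ (count≡sum p e)) ⟨
    sum (λ e → count p e · w e)                       ∎

  -- Stated without subtraction because it serves both the natural numbers, for degrees, and the
  -- reals, for lengths.
  sum-updateAt : ∀ {m} (w : Fin m → Carrier) e y →
                 sum (updateAt w e (const y)) + w e ≈ sum w + y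
  sum-updateAt {suc m} w zero y = begin
    (y + sum (w ∘ suc)) + w zero ≈⟨ +-comm _ _ ⟩
    w zero + (y + sum (w ∘ suc)) ≈⟨ +-congˡ (+-comm _ _) ⟩
    w zero + (sum (w ∘ suc) + y) ≈⟨ +-assoc _ _ _ ⟨
    sum w + y                    ∎
  sum-updateAt {suc m} w (suc e) y = begin
    (w zero + sum (updateAt (w ∘ suc) e (const y))) + w (suc e) ≈⟨ +-assoc _ _ _ ⟩
    w zero + (sum (updateAt (w ∘ suc) e (const y)) + w (suc e)) ≈⟨ +-congˡ (sum-updateAt (w ∘ suc) e y) ⟩
    w zero + (sum (w ∘ suc) + y)                                ≈⟨ +-assoc _ _ _ ⟨
    sum w + y                                                   ∎

  sum-++ : ∀ {k m} (v : Fin k → Carrier) (w : Fin m → Carrier) →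
           sum (λ i → [ v , w ] (splitAt k i)) ≈ sum v + sum w
  sum-++ {zero}  v w = ≈-sym (+-identityˡ _)
  sum-++ {suc k} v w = ≈-trans
    (+-congˡ (≈-trans (sum-cong-≋ step) (sum-++ (v ∘ suc) w))) (≈-sym (+-assoc _ _ _))
    where
    step : ∀ i → [ v , w ] (splitAt (suc k) (suc i)) ≈ [ v ∘ suc , w ] (splitAt k i)
    step i with splitAt k i
    ... | inj₁ _ = ≈-refl
    ... | inj₂ _ = ≈-refl

open FiniteSums ℕₚ.+-0-commutativeMonoid using () renaming
  (sum-updateAt to ℕ-sum-updateAt) public

count-injective : ∀ {k m} (p : Fin k → Fin m) → Injective _≡_ _≡_ p → ∀ i → count p (p i) ≡ 1
count-injective {suc k} p inj i = trans (count≡sum p (p i))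
  (trans (ℕ∑.sum-remove {i = i} (λ j → 𝟙 (p j ≟ᶠ p i)))
    (cong₂ ℕ._+_ (𝟙-yes (p i ≟ᶠ p i) refl)
      (sum-zero _ λ j → 𝟙-no (p (punchIn i j) ≟ᶠ p i) (punchInᵢ≢i i j ∘ inj))))

insert-self : ∀ {k m} i j (π : Permutation k m) → Perm.insert i j π ⟨$⟩ʳ i ≡ j
insert-self i j π with i ≟ᶠ i
... | yes _  = refl
... | no i≢i = contradiction refl i≢i

-- Induction on `k`: the value `p zero` is punched out of the codomain, and the remaining values
-- form an injection into one element fewer. Applied to parent edges, it numbers them first and the
-- other edges after them, which is the order of the edges in `star`.
extend-injection : ∀ {k m} (p : Fin k → Fin m) → Injective _≡_ _≡_ p →
  ∃[ r ] Σ[ σ ∈ Permutation (k ℕ.+ r) m ] (∀ i → σ ⟨$⟩ʳ (i ↑ˡ r) ≡ p i)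
extend-injection {zero} {m} p inj = m , Perm.id , λ ()
extend-injection {suc k} {zero} p inj with p zero
... | ()
extend-injection {suc k} {suc m} p inj =
  r , Perm.insert zero (p zero) σ , agrees
  where
  p₀≢ : ∀ i → p zero ≢ p (suc i)
  p₀≢ i eq with inj eq
  ... | ()
  rest = extend-injection (λ i → punchOut (p₀≢ i))
           (λ eq → suc-injective (inj (punchOut-injective (p₀≢ _) (p₀≢ _) eq)))
  r = proj₁ rest
  σ = proj₁ (proj₂ rest)
  agrees : ∀ i → Perm.insert zero (p zero) σ ⟨$⟩ʳ (i ↑ˡ r) ≡ p i
  agrees zero    = insert-self zero (p zero) σ
  agrees (suc i) = trans (Perm.insert-punchIn zero (p zero) σ (i ↑ˡ r))
    (trans (cong (punchIn (p zero)) (proj₂ (proj₂ rest) i)) (punchIn-punchOut (p₀≢ i)))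

-- A solver for equations in abelian groups.

-- The normal form of an expression lists, for each variable, how often it is
-- added and how often it is subtracted, one of the two numbers being zero.
module AbelianGroupSolver {c ℓ} (G : AbelianGroup c ℓ) where

  open AbelianGroup G using (Carrier; _≈_; setoid; monoid; commutativeSemigroup) renaming
    ( _∙_ to _+_; ε to 0#; _⁻¹ to -_; ∙-cong to +-cong; ∙-congˡ to +-congˡ; ∙-congʳ to +-congʳ
    ; ⁻¹-cong to -‿cong; inverseʳ to -‿inverseʳ
    ; identityˡ to +-identityˡ; identityʳ to +-identityʳ
    ; refl to ≈-refl; sym to ≈-sym; trans to ≈-trans )
  open AbelianGroupProperties G using (⁻¹-anti-homo‿-; ⁻¹-∙-comm; ε⁻¹≈ε)
  open CommutativeSemigroupProperties commutativeSemigroup using (interchange)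
  open MonoidMult monoid using (×-homo-+) renaming (_×_ to _·_)
  open SetoidReasoning setoid

  infixl 6 _⊞_ _⊟_

  data Expr (n : ℕ) : Set where
    var : Fin n → Expr n
    𝟎   : Expr n
    _⊞_ : Expr n → Expr n → Expr n
    _⊟_ : Expr n → Expr n → Expr n

  ⟦_⟧ : ∀ {n} → Expr n → Vec Carrier n → Carrier
  ⟦ var i ⟧ ρ = Vec.lookup ρ i
  ⟦ 𝟎 ⟧ ρ     = 0#
  ⟦ e ⊞ f ⟧ ρ = ⟦ e ⟧ ρ + ⟦ f ⟧ ρ
  ⟦ e ⊟ f ⟧ ρ = ⟦ e ⟧ ρ + - ⟦ f ⟧ ρ

  Coefficients : ℕ → Set
  Coefficients = Vec (ℕ × ℕ)

  scale : ℕ × ℕ → Carrier → Carrier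
  scale (m , k) x = m · x + - (k · x)

  value : ∀ {n} → Coefficients n → Vec Carrier n → Carrier
  value []       []      = 0#
  value (z ∷ zs) (x ∷ ρ) = scale z x + value zs ρ

  cancel : ℕ × ℕ → ℕ × ℕ
  cancel (suc m , suc k) = cancel (m , k)
  cancel z               = z

  add sub : ℕ × ℕ → ℕ × ℕ → ℕ × ℕ
  add (m , k) (m′ , k′) = cancel (m ℕ.+ m′ , k ℕ.+ k′)
  sub (m , k) (m′ , k′) = cancel (m ℕ.+ k′ , k ℕ.+ m′)

  normalise : ∀ {n} → Expr n → Coefficients n
  normalise (var zero)    = (1 , 0) ∷ Vec.replicate _ (0 , 0)
  normalise (var (suc i)) = (0 , 0) ∷ normalise (var i)
  normalise 𝟎             = Vec.replicate _ (0 , 0)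
  normalise (e ⊞ f)       = Vec.zipWith add (normalise e) (normalise f)
  normalise (e ⊟ f)       = Vec.zipWith sub (normalise e) (normalise f)

  medial-sub : ∀ w x y z → (w + x) + - (y + z) ≈ (w + - y) + (x + - z)
  medial-sub w x y z = ≈-trans (+-congˡ (≈-sym (⁻¹-∙-comm y z))) (interchange w x (- y) (- z))

  scale-0 : ∀ x → scale (0 , 0) x ≈ 0#
  scale-0 x = -‿inverseʳ 0#

  scale-cancel : ∀ z x → scale (cancel z) x ≈ scale z x
  scale-cancel (zero , k)      x = ≈-refl
  scale-cancel (suc m , zero)  x = ≈-refl
  scale-cancel (suc m , suc k) x = begin
    scale (cancel (m , k)) x              ≈⟨ scale-cancel (m , k) x ⟩
    m · x + - (k · x)                     ≈⟨ +-identityˡ _ ⟨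
    0# + (m · x + - (k · x))              ≈⟨ +-congʳ (-‿inverseʳ x) ⟨
    (x + - x) + (m · x + - (k · x))       ≈⟨ medial-sub x (m · x) x (k · x) ⟨
    (x + m · x) + - (x + k · x)           ∎

  scale-add : ∀ z z′ x → scale (add z z′) x ≈ scale z x + scale z′ x
  scale-add z@(m , k) z′@(m′ , k′) x = begin
    scale (add z z′) x                          ≈⟨ scale-cancel (m ℕ.+ m′ , k ℕ.+ k′) x ⟩
    (m ℕ.+ m′) · x + - ((k ℕ.+ k′) · x)         ≈⟨ +-cong (×-homo-+ x m m′) (-‿cong (×-homo-+ x k k′)) ⟩
    (m · x + m′ · x) + - (k · x + k′ · x)       ≈⟨ medial-sub _ _ _ _ ⟩
    scale z x + scale z′ x                      ∎

  scale-sub : ∀ z z′ x → scale (sub z z′) x ≈ scale z x + - scale z′ x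
  scale-sub z@(m , k) (m′ , k′) x =
    ≈-trans (scale-add z (k′ , m′) x) (+-congˡ (≈-sym (⁻¹-anti-homo‿- (m′ · x) (k′ · x))))

  value-0 : ∀ {n} (ρ : Vec Carrier n) → value (Vec.replicate n (0 , 0)) ρ ≈ 0#
  value-0 []      = ≈-refl
  value-0 (x ∷ ρ) = ≈-trans (+-cong (scale-0 x) (value-0 ρ)) (+-identityˡ 0#)

  value-add : ∀ {n} zs zs′ (ρ : Vec Carrier n) →
              value (Vec.zipWith add zs zs′) ρ ≈ value zs ρ + value zs′ ρ
  value-add []       []         []      = ≈-sym (+-identityˡ 0#)
  value-add (z ∷ zs) (z′ ∷ zs′) (x ∷ ρ) =
    ≈-trans (+-cong (scale-add z z′ x) (value-add zs zs′ ρ)) (interchange _ _ _ _)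

  value-sub : ∀ {n} zs zs′ (ρ : Vec Carrier n) →
              value (Vec.zipWith sub zs zs′) ρ ≈ value zs ρ + - value zs′ ρ
  value-sub []       []         []      = ≈-sym (-‿inverseʳ 0#)
  value-sub (z ∷ zs) (z′ ∷ zs′) (x ∷ ρ) =
    ≈-trans (+-cong (scale-sub z z′ x) (value-sub zs zs′ ρ)) (≈-sym (medial-sub _ _ _ _))

  correct : ∀ {n} (e : Expr n) ρ → value (normalise e) ρ ≈ ⟦ e ⟧ ρ
  correct (var zero) (x ∷ ρ) = begin
    ((x + 0#) + - 0#) + value (Vec.replicate _ (0 , 0)) ρ ≈⟨ +-cong (+-cong (+-identityʳ x) ε⁻¹≈ε) (value-0 ρ) ⟩
    (x + 0#) + 0#                 ≈⟨ ≈-trans (+-identityʳ _) (+-identityʳ x) ⟩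
    x                             ∎
  correct (var (suc i)) (x ∷ ρ) =
    ≈-trans (+-cong (scale-0 x) (correct (var i) ρ)) (+-identityˡ _)
  correct 𝟎       ρ = value-0 ρ
  correct (e ⊞ f) ρ =
    ≈-trans (value-add (normalise e) (normalise f) ρ) (+-cong (correct e ρ) (correct f ρ))
  correct (e ⊟ f) ρ =
    ≈-trans (value-sub (normalise e) (normalise f) ρ)
            (+-cong (correct e ρ) (-‿cong (correct f ρ)))

  open Reflection setoid var ⟦_⟧ (λ e → value (normalise e)) correct public
    using (solve; _⊜_)

-- Order, halving and tight sums over the reals.

module Reals {a : Level} (em : ExcludedMiddle a) (ℝ : RealNumbers a) where

  open RealNumbers ℝ public hiding (zero; refl; sym; trans; reflexive)
  open RealNumbers ℝ using () renaming
    (refl to ≈-refl; sym to ≈-sym; trans to ≈-trans; reflexive to ≈-reflexive) public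
  open IsTotalOrder isTotalOrder using (total) renaming
    (refl to ≤-refl; trans to ≤-trans; antisym to ≤-antisym; reflexive to ≤-reflexive) public
  open AbelianGroupSolver +-abelianGroup using (solve; _⊜_; _⊞_; _⊟_; 𝟎) public
  open FiniteSums (AbelianGroup.commutativeMonoid +-abelianGroup) public
    using (sum-·; sum-fibres; sum-updateAt; sum-++; sum-remove; sum-permute; sum-cong-≋; ∑-distrib-+; sum-replicate)
  open MonoidMult +-monoid public using (×-homo-+; ×-congˡ; ×-congʳ; ×-assocˡ)

  +-monoˡ-≤ : ∀ z {x y} → x ≤ y → x + z ≤ y + z
  +-monoˡ-≤ z x≤y = ≤-trans (≤-reflexive (+-comm _ z)) (≤-trans (+-monoʳ-≤ z x≤y) (≤-reflexive (+-comm z _)))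

  +-mono-≤ : ∀ {w x y z} → w ≤ x → y ≤ z → w + y ≤ x + z
  +-mono-≤ w≤x y≤z = ≤-trans (+-monoˡ-≤ _ w≤x) (+-monoʳ-≤ _ y≤z)

  -- The certificate form of a linear deduction: x ≤ y follows from u ≤ v when
  -- the two differences agree, which is left to the solver.
  ≤-shift : ∀ {u v x y} → u ≤ v → v - u ≈ y - x → x ≤ y
  ≤-shift {u} {v} {x} {y} u≤v eq = ≤-trans
    (≤-reflexive (solve 2 (λ u x → x ⊜ u ⊞ (x ⊟ u)) ≈-refl u x))
    (≤-trans (+-monoˡ-≤ (x - u) u≤v) (≤-reflexive (begin
      v + (x - u)  ≈⟨ solve 3 (λ u v x → v ⊞ (x ⊟ u) ⊜ (v ⊟ u) ⊞ x) ≈-refl u v x ⟩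
      (v - u) + x  ≈⟨ +-congʳ eq ⟩
      (y - x) + x  ≈⟨ solve 2 (λ x y → (y ⊟ x) ⊞ x ⊜ y) ≈-refl x y ⟩
      y            ∎)))
    where open SetoidReasoning setoid

  infix 4 _≟_

  _≟_ : ∀ x y → Dec (x ≈ y)
  x ≟ y = em

  <-irrefl : ∀ {x y} → x ≈ y → ¬ x < y
  <-irrefl x≈y x<y = proj₂ x<y x≈y

  ≤⇒≯ : ∀ {x y} → x ≤ y → ¬ y < x
  ≤⇒≯ x≤y (y≤x , y≉x) = y≉x (≤-antisym y≤x x≤y)

  <-≤-trans : ∀ {x y z} → x < y → y ≤ z → x < z
  <-≤-trans (x≤y , x≉y) y≤z = ≤-trans x≤y y≤z , λ x≈z → x≉y (≤-antisym x≤y (≤-trans y≤z (≤-reflexive (≈-sym x≈z))))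

  ≤-<-trans : ∀ {x y z} → x ≤ y → y < z → x < z
  ≤-<-trans x≤y (y≤z , y≉z) = ≤-trans x≤y y≤z , λ x≈z → y≉z (≤-antisym y≤z (≤-trans (≤-reflexive (≈-sym x≈z)) x≤y))

  <-trans : ∀ {x y z} → x < y → y < z → x < z
  <-trans x<y y<z = <-≤-trans x<y (proj₁ y<z)

  ≈-shift : ∀ {u v x y} → u ≈ v → v - u ≈ y - x → x ≈ y
  ≈-shift {u} {v} {x} {y} u≈v eq = ≤-antisym
    (≤-shift (≤-reflexive u≈v) eq)
    (≤-shift (≤-reflexive (≈-sym u≈v)) (begin
      u - v        ≈⟨ solve 2 (λ u v → u ⊟ v ⊜ 𝟎 ⊟ (v ⊟ u)) ≈-refl u v ⟩
      0# - (v - u) ≈⟨ +-congˡ (-‿cong eq) ⟩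
      0# - (y - x) ≈⟨ solve 2 (λ x y → 𝟎 ⊟ (y ⊟ x) ⊜ x ⊟ y) ≈-refl x y ⟩
      x - y        ∎))
    where open SetoidReasoning setoid

  <-shift : ∀ {u v x y} → u < v → v - u ≈ y - x → x < y
  <-shift (u≤v , u≉v) eq = ≤-shift u≤v eq , λ x≈y → u≉v (≈-shift x≈y (≈-sym eq))

  ≤-decided : ∀ {x y} → x ≤ y → x ≈ y ⊎ x < y
  ≤-decided {x} {y} x≤y with x ≟ y
  ... | yes x≈y = inj₁ x≈y
  ... | no  x≉y = inj₂ (x≤y , x≉y)

  0≤1 : 0# ≤ 1#
  0≤1 with total 0# 1#
  ... | inj₁ 0≤1 = 0≤1
  -- If `1#` were at most `0#`, then `- 1#` would be nonnegative, and so would be its square `1#`.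
  ... | inj₂ 1≤0 = ≤-trans (*-nonneg 0≤-1 0≤-1) (≤-reflexive
      (≈-trans (-x*-y≈x*y 1# 1#) (*-identityˡ 1#)))
    where
    open RingProperties ring using (-‿distribˡ-*; -‿distribʳ-*; -‿involutive)
    0≤-1 : 0# ≤ - 1#
    0≤-1 = ≤-trans (≤-shift 1≤0 (solve 1 (λ o → 𝟎 ⊟ o ⊜ (𝟎 ⊟ o) ⊟ 𝟎) ≈-refl 1#))
                   (≤-reflexive (+-identityˡ (- 1#)))
    -x*-y≈x*y : ∀ x y → - x * - y ≈ x * y
    -x*-y≈x*y x y = ≈-trans (≈-sym (-‿distribˡ-* x (- y)))
      (≈-trans (-‿cong (≈-sym (-‿distribʳ-* x y))) (-‿involutive (x * y)))

  -- Used to locate the farthest point of an edge. The inverse of `1# + 1#` exists because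
  -- `1# ≤ 1# + 1#` excludes `1# + 1# ≈ 0#`.
  halve : ∀ x → ∃ λ h → h + h ≈ x
  halve x = x * proj₁ ½ , (begin
    x * h + x * h    ≈⟨ distribˡ x h h ⟨
    x * (h + h)      ≈⟨ *-congˡ (+-cong (*-identityˡ h) (*-identityˡ h)) ⟨
    x * (1# * h + 1# * h) ≈⟨ *-congˡ (distribʳ h 1# 1#) ⟨
    x * ((1# + 1#) * h) ≈⟨ *-congˡ (proj₂ ½) ⟩
    x * 1#           ≈⟨ *-identityʳ x ⟩
    x                ∎)
    where
    open SetoidReasoning setoid
    2≉0 : ¬ 1# + 1# ≈ 0#
    2≉0 2≈0 = 0≉1 (≤-antisym 0≤1 (≤-trans (≤-shift 0≤1
      (solve 1 (λ o → o ⊟ 𝟎 ⊜ (o ⊞ o) ⊟ o) ≈-refl 1#)) (≤-reflexive 2≈0)))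
    ½ = inverse (1# + 1#) 2≉0
    h = proj₁ ½

  double-≤ : ∀ {x y} → x + x ≤ y + y → x ≤ y
  double-≤ {x} {y} 2x≤2y with total x y
  ... | inj₁ x≤y = x≤y
  ... | inj₂ y≤x = ≤-shift (+-mono-≤ y≤x 2x≤2y)
    (solve 2 (λ x y → (x ⊞ (y ⊞ y)) ⊟ (y ⊞ (x ⊞ x)) ⊜ y ⊟ x) ≈-refl x y)

  sum-mono-≤ : ∀ {k} (f g : Fin k → Carrier) → (∀ i → f i ≤ g i) → sum f ≤ sum g
  sum-mono-≤ {zero}  f g f≤g = ≤-refl
  sum-mono-≤ {suc k} f g f≤g = +-mono-≤ (f≤g zero) (sum-mono-≤ (f ∘ suc) (g ∘ suc) (f≤g ∘ suc))

  -- When the sums satisfy the reversed inequality, neither summand can be slack. With `sum-tight`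
  -- this turns equality of the totals into equality at every edge and every vertex.
  +-tight : ∀ {w x y z} → w ≤ x → y ≤ z → x + z ≤ w + y → w ≈ x × y ≈ z
  +-tight {w} {x} {y} {z} w≤x y≤z x+z≤w+y =
      ≤-antisym w≤x (≤-shift (+-mono-≤ y≤z x+z≤w+y)
        (solve 4 (λ w x y z → (z ⊞ (w ⊞ y)) ⊟ (y ⊞ (x ⊞ z)) ⊜ w ⊟ x) ≈-refl w x y z))
    , ≤-antisym y≤z (≤-shift (+-mono-≤ w≤x x+z≤w+y)
        (solve 4 (λ w x y z → (x ⊞ (w ⊞ y)) ⊟ (w ⊞ (x ⊞ z)) ⊜ y ⊟ z) ≈-refl w x y z))

  sum-tight : ∀ {k} (f g : Fin k → Carrier) → (∀ i → f i ≤ g i) → sum g ≤ sum f → ∀ i → f i ≈ g i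
  sum-tight {suc k} f g f≤g Σg≤Σf i with
    +-tight (f≤g zero) (sum-mono-≤ (f ∘ suc) (g ∘ suc) (f≤g ∘ suc)) Σg≤Σf
  sum-tight f g f≤g Σg≤Σf zero    | f₀≈g₀ , _   = f₀≈g₀
  sum-tight f g f≤g Σg≤Σf (suc i) | _ , Σf≈Σg =
    sum-tight (f ∘ suc) (g ∘ suc) (f≤g ∘ suc) (≤-reflexive (≈-sym Σf≈Σg)) i

-- Degrees, leaf counts and lengths under isomorphism and subdivision.

module Graphs {a : Level} (em : ExcludedMiddle a) (ℝ : RealNumbers a) where

  open Reals em ℝ public
  open MetricGraphs ℝ public
  open WeightedGraph public

  endsAt : (G : WeightedGraph) → Fin (vertexCount G) → Fin (edgeCount G) → ℕ
  endsAt G v e = 𝟙 (source G e ≟ᶠ v) ℕ.+ 𝟙 (target G e ≟ᶠ v)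

  degree≡sum : ∀ G v → degree G v ≡ ℕ∑.sum (endsAt G v)
  degree≡sum G v = trans (cong₂ ℕ._+_ (count≡sum (source G) v) (count≡sum (target G) v))
                         (sym (ℕ∑.∑-distrib-+ _ (λ e → 𝟙 (target G e ≟ᶠ v))))

  endsAt≡0⇒ : ∀ G v e → endsAt G v e ≡ 0 → source G e ≢ v × target G e ≢ v
  endsAt≡0⇒ G v e eq =
      (λ s≡v → 1≢0 (trans (sym (𝟙-yes (source G e ≟ᶠ v) s≡v)) (ℕₚ.m+n≡0⇒m≡0 (𝟙 (source G e ≟ᶠ v)) eq)))
    , (λ t≡v → 1≢0 (trans (sym (𝟙-yes (target G e ≟ᶠ v) t≡v)) (ℕₚ.m+n≡0⇒n≡0 (𝟙 (source G e ≟ᶠ v)) eq)))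
    where
    1≢0 : 1 ≢ 0
    1≢0 ()

  leafCount≡sum : ∀ G → leafCount G ≡ ℕ∑.sum (λ v → 𝟙 (degree G v ℕₚ.≟ 1))
  leafCount≡sum G = length-filter (λ v → degree G v ℕₚ.≟ 1) id

  module _ {G H : WeightedGraph} (G≅H : G ≅ H) where

    open _≅_ G≅H

    φ-injective : ∀ {v w} → φ v ≡ φ w → v ≡ w
    φ-injective eq = trans (sym (Perm.inverseˡ onVertices))
      (trans (cong (onVertices ⟨$⟩ˡ_) eq) (Perm.inverseˡ onVertices))

    endsAt-≅ : ∀ v e → endsAt H (φ v) (ψ e) ≡ endsAt G v e
    endsAt-≅ v e = [ (λ { (s≡ , t≡) → cong₂ ℕ._+_ (same s≡) (same t≡) })
                   , (λ { (s≡ , t≡) → trans (cong₂ ℕ._+_ (same s≡) (same t≡)) (ℕₚ.+-comm (𝟙 (target G e ≟ᶠ v)) _) })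
                   ]′ (ends-preserved e)
      where
      same : ∀ {w x} → w ≡ φ x → 𝟙 (w ≟ᶠ φ v) ≡ 𝟙 (x ≟ᶠ v)
      same w≡φx = 𝟙-cong (_ ≟ᶠ _) (_ ≟ᶠ _)
        (λ w≡φv → φ-injective (trans (sym w≡φx) w≡φv)) (λ x≡v → trans w≡φx (cong φ x≡v))

    degree-≅ : ∀ v → degree H (φ v) ≡ degree G v
    degree-≅ v = trans (degree≡sum H (φ v)) (trans (ℕ∑.sum-permute (endsAt H (φ v)) onEdges)
      (trans (ℕ∑.sum-cong-≗ (endsAt-≅ v)) (sym (degree≡sum G v))))

    leafCount-≅ : leafCount H ≡ leafCount G
    leafCount-≅ = trans (leafCount≡sum H)
      (trans (ℕ∑.sum-permute (λ v → 𝟙 (degree H v ℕₚ.≟ 1)) onVertices)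
      (trans (ℕ∑.sum-cong-≗ (λ v → cong (λ d → 𝟙 (d ℕₚ.≟ 1)) (degree-≅ v)))
             (sym (leafCount≡sum G))))

    cyc-≅ : cyc H ≡ cyc G
    cyc-≅ = sym (cong₂ (λ m n → (m ℕ.+ 1) ℕ.∸ n) (Perm.↔⇒≡ onEdges) (Perm.↔⇒≡ onVertices))

    totalLength-≅ : totalLength H ≈ totalLength G
    totalLength-≅ = ≈-trans (sum-permute (len H) onEdges) (sum-cong-≋ len-preserved)

  module _ (G : WeightedGraph) (e : Fin (edgeCount G)) (b c : Carrier) where

    private
      S = split G e b c

    -- Cutting `e` takes its target end away from the old vertex, and the new edge zero gives that
    -- end back; the source ends are untouched.
    degree-split : ∀ v → degree S (suc v) ≡ degree G v
    degree-split v = cong₂ ℕ._+_ sources targets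
      where
      𝟙ₜ : Fin (edgeCount G) → ℕ
      𝟙ₜ j = 𝟙 (target G j ≟ᶠ v)
      sources : count (source S) (suc v) ≡ count (source G) v
      sources = trans (count≡sum (source S) (suc v)) (sym (count≡sum (source G) v))
      targets : count (target S) (suc v) ≡ count (target G) v
      targets = trans (count≡sum (target S) (suc v)) (trans
        (cong (𝟙ₜ e ℕ.+_) (ℕ∑.sum-cong-≗ (Vectorₚ.map-updateAt
          {f = λ x → 𝟙 (x ≟ᶠ suc v)} {g = const zero} {h = const 0} (λ _ → refl) (suc ∘ target G) e)))
        (trans (ℕₚ.+-comm (𝟙ₜ e) _) (trans (ℕ-sum-updateAt 𝟙ₜ e 0)
        (trans (ℕₚ.+-identityʳ _) (sym (count≡sum (target G) v))))))

    degree-split-zero : degree S zero ≡ 2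
    degree-split-zero = cong₂ ℕ._+_
      (trans (count≡sum (source S) zero) (cong suc (sum-zero {edgeCount G} (const 0) (λ _ → refl))))
      (trans (count≡sum (target S) zero) (trans
        (ℕ∑.sum-cong-≗ (Vectorₚ.map-updateAt
          {f = λ x → 𝟙 (x ≟ᶠ zero)} {g = const zero} {h = const 1} (λ _ → refl) (suc ∘ target G) e))
        (trans (sym (ℕₚ.+-identityʳ _)) (trans (ℕ-sum-updateAt (const 0) e 1)
          (cong (ℕ._+ 1) (sum-zero {edgeCount G} (const 0) (λ _ → refl)))))))

    leafCount-split : leafCount S ≡ leafCount G
    leafCount-split = trans (leafCount≡sum S) (trans
      (cong₂ ℕ._+_ (cong (λ d → 𝟙 (d ℕₚ.≟ 1)) degree-split-zero)
        (ℕ∑.sum-cong-≗ (λ v → cong (λ d → 𝟙 (d ℕₚ.≟ 1)) (degree-split v))))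
      (sym (leafCount≡sum G)))

    totalLength-split : b + c ≈ len G e → totalLength S ≈ totalLength G
    totalLength-split b+c≈l = ≈-shift (+-cong (sum-updateAt (len G) e b) b+c≈l)
      (solve 5 (λ b c l u t → (t ⊞ b) ⊞ l ⊟ ((u ⊞ l) ⊞ (b ⊞ c)) ⊜ t ⊟ (c ⊞ u)) ≈-refl
        b c (len G e) (sum (updateAt (len G) e (const b))) (totalLength G))

  totalLength-∼ : ∀ {G H} → G ∼ H → totalLength G ≈ totalLength H
  totalLength-∼ = EqClosure.gfold isEquivalence totalLength step
    where
    step : ∀ {G H} → Step G H → totalLength G ≈ totalLength H
    step (relabel G≅H)                = ≈-sym (totalLength-≅ G≅H)
    step (subdivide {G} e b c _ _ eq) = ≈-sym (totalLength-split G e b c eq)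

  totalLength-star : ∀ k c R → totalLength (star k c R) ≈ (2 ℕ.* c ℕ.+ k) · R
  totalLength-star k c R = begin
    totalLength (star k c R)      ≈⟨ sum-++ (λ (_ : Fin k) → R) (λ (_ : Fin c) → 2 · R) ⟩
    sum {k} (const R) + sum {c} (const (2 · R))
                                  ≈⟨ +-cong (sum-replicate k) (sum-replicate c) ⟩
    k · R + c · (2 · R)           ≈⟨ +-comm _ _ ⟩
    c · (2 · R) + k · R           ≈⟨ +-congʳ (×-assocˡ R c 2) ⟩
    (c ℕ.* 2) · R + k · R         ≈⟨ ×-homo-+ R (c ℕ.* 2) k ⟨
    (c ℕ.* 2 ℕ.+ k) · R           ≈⟨ ×-congˡ (cong (ℕ._+ k) (ℕₚ.*-comm c 2)) ⟩
    (2 ℕ.* c ℕ.+ k) · R           ∎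
    where open SetoidReasoning setoid

-- Potentials: heights, parent edges and peaks.

module Potentials {a : Level} (em : ExcludedMiddle a) (ℝ : RealNumbers a) where

  open Graphs em ℝ public

  Joins : (G : WeightedGraph) → Fin (edgeCount G) → (v w : Fin (vertexCount G)) → Set
  Joins G e v w = (source G e ≡ v × target G e ≡ w) ⊎ (source G e ≡ w × target G e ≡ v)

  Joins-sym : ∀ {G e v w} → Joins G e v w → Joins G e w v
  Joins-sym (inj₁ st) = inj₂ st
  Joins-sym (inj₂ st) = inj₁ st

  Joins-unique : ∀ {G e v w v′ w′} → Joins G e v w → Joins G e v′ w′ →
                 (v ≡ v′ × w ≡ w′) ⊎ (v ≡ w′ × w ≡ v′)
  Joins-unique (inj₁ (refl , refl)) (inj₁ (refl , refl)) = inj₁ (refl , refl)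
  Joins-unique (inj₁ (refl , refl)) (inj₂ (refl , refl)) = inj₂ (refl , refl)
  Joins-unique (inj₂ (refl , refl)) (inj₁ (refl , refl)) = inj₂ (refl , refl)
  Joins-unique (inj₂ (refl , refl)) (inj₂ (refl , refl)) = inj₁ (refl , refl)

  Joins-endsAt : ∀ {G e v w} → Joins G e v w → w ≢ v → endsAt G v e ≡ 1
  Joins-endsAt {G} {e} {v} (inj₁ (refl , refl)) w≢v =
    cong₂ ℕ._+_ (𝟙-yes (source G e ≟ᶠ v) refl) (𝟙-no (target G e ≟ᶠ v) w≢v)
  Joins-endsAt {G} {e} {v} (inj₂ (refl , refl)) w≢v =
    cong₂ ℕ._+_ (𝟙-no (source G e ≟ᶠ v) w≢v) (𝟙-yes (target G e ≟ᶠ v) refl)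

  -- The height is the distance from the root, and half of the peak of an edge
  -- is the height of its farthest point.
  record Potential (G : WeightedGraph) (R : Carrier) : Set a where
    field
      root          : Fin (vertexCount G)
      height        : Fin (vertexCount G) → Carrier
      0≤R           : 0# ≤ R
      len-positive  : ∀ e → 0# < len G e
      height-root   : height root ≈ 0#
      height-nonneg : ∀ v → 0# ≤ height v
      parent        : ∀ v → v ≢ root → ∃ λ e → ∃ λ w →
                      Joins G e v w × height v ≈ height w + len G e

    peak : Fin (edgeCount G) → Carrier
    peak e = (height (source G e) + height (target G e)) + len G e

    field
      peak-≤ : ∀ e → peak e ≤ R + R

    peak-Joins : ∀ {e v w} → Joins G e v w → peak e ≈ (height v + height w) + len G e
    peak-Joins (inj₁ (refl , refl)) = ≈-refl
    peak-Joins (inj₂ (refl , refl)) = +-congʳ (+-comm _ _)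

    peak-parent : ∀ {e v w} → Joins G e v w → height v ≈ height w + len G e →
                  peak e ≈ height v + height v
    peak-parent {e} {v} {w} j eq = ≈-trans (peak-Joins j)
      (≈-trans (+-assoc _ _ _) (+-congˡ (≈-sym eq)))

    parent-higher : ∀ {e v w} → height v ≈ height w + len G e → height w < height v
    parent-higher {e} {v} {w} eq = <-≤-trans
      (<-shift (len-positive e) (solve 2 (λ w l → l ⊟ 𝟎 ⊜ (w ⊞ l) ⊟ w) ≈-refl (height w) (len G e)))
      (≤-reflexive (≈-sym eq))

    parent-≢ : ∀ {e v w} → height v ≈ height w + len G e → w ≢ v
    parent-≢ eq refl = proj₂ (parent-higher eq) ≈-refl

    height-positive : ∀ v → v ≢ root → 0# < height v
    height-positive v v≢r with parent v v≢r
    ... | e , w , _ , eq = ≤-<-trans (height-nonneg w) (parent-higher eq)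

    height-≤ : ∀ v → v ≢ root → height v ≤ R
    height-≤ v v≢r with parent v v≢r
    ... | e , w , j , eq = double-≤ (≤-trans (≤-reflexive (≈-sym (peak-parent j eq))) (peak-≤ e))

    -- Every peak is at least the length of its edge, hence positive, and `R + R` bounds it. This
    -- positivity is what later keeps the root from being a leaf.
    edge⇒0<R : Fin (edgeCount G) → 0# < R
    edge⇒0<R e = 0≤R , λ 0≈R → ≤⇒≯ (peak-≤ e) (≤-<-trans
      (≤-trans (≤-reflexive (+-cong (≈-sym 0≈R) (≈-sym 0≈R)))
               (+-mono-≤ (height-nonneg (source G e)) (height-nonneg (target G e))))
      (<-shift (len-positive e) (solve 2 (λ h l → l ⊟ 𝟎 ⊜ (h ⊞ l) ⊟ h) ≈-refl _ (len G e))))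

  -- The length estimate and its equality case.

  module Extremal {n m : ℕ} (s t : Vector (Fin (suc n)) m) (l : Vector Carrier m) where

    G : WeightedGraph
    G = record { vertexCount = suc n ; edgeCount = m ; source = s ; target = t ; len = l }

    module _ {R : Carrier} (P : Potential G R) where

      open Potential P

      -- The graph is given by its fields so that its vertex count is literally `suc n`; this lets
      -- `punchIn root` enumerate the other vertices by `Fin n`.
      vertexAt : Fin n → Fin (suc n)
      vertexAt = punchIn root

      vertexAt≢root : ∀ i → vertexAt i ≢ root
      vertexAt≢root i = punchInᵢ≢i root i

      parentEdge : Fin n → Fin m
      parentEdge i = proj₁ (parent (vertexAt i) (vertexAt≢root i))

      parentEnd : Fin n → Fin (suc n)
      parentEnd i = proj₁ (proj₂ (parent (vertexAt i) (vertexAt≢root i)))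

      parent-Joins : ∀ i → Joins G (parentEdge i) (vertexAt i) (parentEnd i)
      parent-Joins i = proj₁ (proj₂ (proj₂ (parent (vertexAt i) (vertexAt≢root i))))

      parent-height : ∀ i → height (vertexAt i) ≈ height (parentEnd i) + l (parentEdge i)
      parent-height i = proj₂ (proj₂ (proj₂ (parent (vertexAt i) (vertexAt≢root i))))

      -- If two different vertices shared a parent edge, each would be the parent end of the other,
      -- hence strictly lower than it.
      parentEdge-injective : Injective _≡_ _≡_ parentEdge
      parentEdge-injective {i} {j} eq with Joins-unique {G}
        (parent-Joins i) (subst (λ e → Joins G e (vertexAt j) (parentEnd j)) (sym eq) (parent-Joins j))
      ... | inj₁ (v≡v′ , _)    = punchIn-injective root i j v≡v′
      ... | inj₂ (v≡w′ , w≡v′) = contradiction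
        (<-trans (parent-higher (parent-height i))
          (≤-<-trans (≤-reflexive (≈-reflexive (cong height v≡w′)))
            (<-≤-trans (parent-higher (parent-height j))
              (≤-reflexive (≈-reflexive (cong height (sym w≡v′)))))))
        (<-irrefl ≈-refl)

      vertices≤edges : n ℕ.≤ m
      vertices≤edges = injective⇒≤ parentEdge-injective

      -- Injectivity of `parentEdge` gives `n ≤ m`, so the truncated subtraction in `cyc` is exact,
      -- and `cyc G` counts the edges that are no parent edge.
      edges≡ : m ≡ cyc G ℕ.+ n
      edges≡ = trans (sym (ℕₚ.m∸n+n≡m vertices≤edges))
        (cong (λ k → (k ℕ.∸ suc n) ℕ.+ n) (ℕₚ.+-comm 1 m))

      parentCount : Fin m → ℕ
      parentCount = count parentEdge

      isParent? : ∀ e → Dec (∃ λ i → parentEdge i ≡ e)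
      isParent? e = any? (λ i → parentEdge i ≟ᶠ e)

      endsAt-parent : ∀ i → endsAt G (vertexAt i) (parentEdge i) ≡ 1
      endsAt-parent i = Joins-endsAt {G} (parent-Joins i) (parent-≢ (parent-height i))

      D : Carrier
      D = R + R

      -- For a parent edge the count is one and both sides agree; otherwise it is zero and `peak-≤`
      -- remains. The weights allow a single sum over all edges instead of a partition of them.
      -- `bound` abstracts the count, so that matching on `refl` can insert its value.
      edge-≤ : ∀ e → peak e + parentCount e · D ≤ D + parentCount e · peak e
      edge-≤ e with isParent? e
      ... | yes (i , refl) = bound (parentCount e) (count-injective parentEdge parentEdge-injective i)
        where
        bound : ∀ k → k ≡ 1 → peak e + k · D ≤ D + k · peak e
        bound _ refl = ≤-reflexive (solve 2 (λ p d → p ⊞ (d ⊞ 𝟎) ⊜ d ⊞ (p ⊞ 𝟎)) ≈-refl (peak e) D)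
      ... | no ∄i = bound (parentCount e) (count-∉ parentEdge e (λ i eq → ∄i (i , eq)))
        where
        bound : ∀ k → k ≡ 0 → peak e + k · D ≤ D + k · peak e
        bound _ refl = +-monoˡ-≤ 0# (peak-≤ e)

      ·-nonneg : ∀ k {x} → 0# ≤ x → 0# ≤ k · x
      ·-nonneg zero    0≤x = ≤-refl
      ·-nonneg (suc k) 0≤x = ≤-trans (≤-reflexive (≈-sym (+-identityˡ 0#))) (+-mono-≤ 0≤x (·-nonneg k 0≤x))

      leaf : Fin (suc n) → ℕ
      leaf v = 𝟙 (degree G v ℕₚ.≟ 1)

      degree≢0 : ∀ v → v ≢ root → degree G v ≢ 0
      degree≢0 v v≢r deg≡0 with parent v v≢r
      ... | e , w , j , eq with trans (sym (Joins-endsAt {G} j (parent-≢ eq)))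
        (sum≡0⇒ (endsAt G v) (trans (sym (degree≡sum G v)) deg≡0) e)
      ... | ()

      -- Degree one is completed by `height v ≤ R`, degree two balances, and every further edge end
      -- leaves a surplus of `height v`. At the root the left side vanishes.
      vertex-≤ : ∀ v → height v + height v ≤ degree G v · height v + leaf v · R
      vertex-≤ v with v ≟ᶠ root
      ... | yes refl = ≤-trans (≤-reflexive (≈-trans (+-congʳ height-root) (≈-trans (+-congˡ height-root) (+-identityˡ 0#))))
        (≤-trans (≤-reflexive (≈-sym (+-identityˡ 0#)))
          (+-mono-≤ (·-nonneg (degree G root) (height-nonneg root)) (·-nonneg (leaf root) 0≤R)))
      ... | no v≢r = bound (degree G v) refl
        where
        h = height v
        bound : ∀ d → degree G v ≡ d → h + h ≤ d · h + 𝟙 (d ℕₚ.≟ 1) · R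
        bound 0 deg≡0 = contradiction deg≡0 (degree≢0 v v≢r)
        bound 1 _ = ≤-shift (height-≤ v v≢r)
          (solve 2 (λ h r → r ⊟ h ⊜ ((h ⊞ 𝟎) ⊞ (r ⊞ 𝟎)) ⊟ (h ⊞ h)) ≈-refl h R)
        bound 2 _ = ≤-reflexive (solve 1 (λ h → h ⊞ h ⊜ (h ⊞ (h ⊞ 𝟎)) ⊞ 𝟎) ≈-refl h)
        bound (suc (suc (suc k))) _ = ≤-shift (+-mono-≤ (height-nonneg v) (·-nonneg k (height-nonneg v)))
          (solve 2 (λ h x → (h ⊞ x) ⊟ (𝟎 ⊞ 𝟎) ⊜ ((h ⊞ (h ⊞ (h ⊞ x))) ⊞ 𝟎) ⊟ (h ⊞ h)) ≈-refl h (k · h))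

      Σpeak ΣparentHeight ΣdegreeHeight : Carrier
      Σpeak         = sum peak
      ΣparentHeight = sum (λ i → height (vertexAt i) + height (vertexAt i))
      ΣdegreeHeight = sum (λ v → degree G v · height v)

      -- A height occurs in the peaks once for each edge end at its vertex, which is why degrees
      -- appear.
      Σpeak≈ : Σpeak ≈ ΣdegreeHeight + totalLength G
      Σpeak≈ = ≈-trans (∑-distrib-+ (λ e → height (s e) + height (t e)) l) (+-congʳ (begin
        sum (λ e → height (s e) + height (t e))      ≈⟨ ∑-distrib-+ (height ∘ s) (height ∘ t) ⟩
        sum (height ∘ s) + sum (height ∘ t)          ≈⟨ +-cong (sum-fibres s height) (sum-fibres t height) ⟩
        sum (λ v → count s v · height v) + sum (λ v → count t v · height v)
          ≈⟨ ∑-distrib-+ (λ v → count s v · height v) (λ v → count t v · height v) ⟨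
        sum (λ v → count s v · height v + count t v · height v)
          ≈⟨ sum-cong-≋ (λ v → ×-homo-+ (height v) (count s v) (count t v)) ⟨
        ΣdegreeHeight ∎))
        where open SetoidReasoning setoid

      edges-left : sum (λ e → peak e + parentCount e · D) ≈ Σpeak + n · D
      edges-left = ≈-trans (∑-distrib-+ peak (λ e → parentCount e · D))
        (+-congˡ (≈-trans (≈-sym (sum-fibres parentEdge (const D))) (sum-replicate n)))

      edges-right : sum (λ e → D + parentCount e · peak e) ≈ m · D + ΣparentHeight
      edges-right = ≈-trans (∑-distrib-+ (const D) (λ e → parentCount e · peak e))
        (+-cong (sum-replicate m) (≈-trans (≈-sym (sum-fibres parentEdge peak))
          (sum-cong-≋ (λ i → peak-parent (parent-Joins i) (parent-height i)))))

      vertices-left : sum (λ v → height v + height v) ≈ ΣparentHeight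
      vertices-left = ≈-trans (sum-remove {i = root} (λ v → height v + height v))
        (≈-trans (+-congʳ (≈-trans (+-cong height-root height-root) (+-identityˡ 0#))) (+-identityˡ _))

      vertices-right : sum (λ v → degree G v · height v + leaf v · R) ≈ ΣdegreeHeight + leafCount G · R
      vertices-right = ≈-trans (∑-distrib-+ (λ v → degree G v · height v) (λ v → leaf v · R))
        (+-congˡ (≈-trans (sum-· leaf R) (×-congˡ (sym (leafCount≡sum G)))))

      module _ (extremal : totalLength G ≈ (2 ℕ.* cyc G ℕ.+ leafCount G) · R) where

        private
          c = cyc G
          L = leafCount G · R

          total≈ : totalLength G ≈ c · D + L
          total≈ = begin
            totalLength G                       ≈⟨ extremal ⟩
            (2 ℕ.* c ℕ.+ leafCount G) · R       ≈⟨ ×-homo-+ R (2 ℕ.* c) (leafCount G) ⟩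
            (2 ℕ.* c) · R + L                   ≈⟨ +-congʳ (×-congˡ (ℕₚ.*-comm 2 c)) ⟩
            (c ℕ.* 2) · R + L                   ≈⟨ +-congʳ (×-assocˡ R c 2) ⟨
            c · (2 · R) + L                     ≈⟨ +-congʳ (×-congʳ c (+-congˡ (+-identityʳ R))) ⟩
            c · D + L                           ∎
            where open SetoidReasoning setoid

          mD≈ : m · D ≈ c · D + n · D
          mD≈ = ≈-trans (×-congˡ edges≡) (×-homo-+ D c n)

          -- In general the first total exceeds the second by `c · D + L` minus the total length, so
          -- the summed inequalities contain the length bound; extremality makes this excess vanish.
          balance : sum (λ e → D + parentCount e · peak e) + sum (λ v → degree G v · height v + leaf v · R)
                  ≈ sum (λ e → peak e + parentCount e · D) + sum (λ v → height v + height v)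
          balance = begin
            sum (λ e → D + parentCount e · peak e) + sum (λ v → degree G v · height v + leaf v · R)
              ≈⟨ +-cong edges-right vertices-right ⟩
            (m · D + ΣparentHeight) + (ΣdegreeHeight + L)
              ≈⟨ +-congʳ (+-congʳ mD≈) ⟩
            ((c · D + n · D) + ΣparentHeight) + (ΣdegreeHeight + L)
              ≈⟨ solve 5 (λ cd nd p d x → ((cd ⊞ nd) ⊞ p) ⊞ (d ⊞ x) ⊜ ((d ⊞ (cd ⊞ x)) ⊞ nd) ⊞ p) ≈-refl
                   (c · D) (n · D) ΣparentHeight ΣdegreeHeight L ⟩
            ((ΣdegreeHeight + (c · D + L)) + n · D) + ΣparentHeight
              ≈⟨ +-congʳ (+-congʳ (+-congˡ total≈)) ⟨
            ((ΣdegreeHeight + totalLength G) + n · D) + ΣparentHeight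
              ≈⟨ +-congʳ (+-congʳ Σpeak≈) ⟨
            (Σpeak + n · D) + ΣparentHeight
              ≈⟨ +-cong edges-left vertices-left ⟨
            sum (λ e → peak e + parentCount e · D) + sum (λ v → height v + height v) ∎
            where open SetoidReasoning setoid

          tight : sum (λ e → peak e + parentCount e · D) ≈ sum (λ e → D + parentCount e · peak e)
                × sum (λ v → height v + height v) ≈ sum (λ v → degree G v · height v + leaf v · R)
          tight = +-tight (sum-mono-≤ _ _ edge-≤) (sum-mono-≤ _ _ vertex-≤) (≤-reflexive balance)

          edge-≈ : ∀ e → peak e + parentCount e · D ≈ D + parentCount e · peak e
          edge-≈ = sum-tight _ _ edge-≤ (≤-reflexive (≈-sym (proj₁ tight)))

          vertex-≈ : ∀ v → height v + height v ≈ degree G v · height v + leaf v · R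
          vertex-≈ = sum-tight _ _ vertex-≤ (≤-reflexive (≈-sym (proj₂ tight)))

        peak-maximal : ∀ e → (∀ i → parentEdge i ≢ e) → peak e ≈ D
        peak-maximal e ∉ = cases (parentCount e) (count-∉ parentEdge e ∉) (edge-≈ e)
          where
          cases : ∀ k → k ≡ 0 → peak e + k · D ≈ D + k · peak e → peak e ≈ D
          cases _ refl eq = ≈-trans (≈-sym (+-identityʳ _)) (≈-trans eq (+-identityʳ _))

        degree-one-or-two : ∀ v → v ≢ root → (degree G v ≡ 1 × height v ≈ R) ⊎ degree G v ≡ 2
        degree-one-or-two v v≢r = cases (degree G v) refl (vertex-≈ v)
          where
          h = height v
          cases : ∀ d → degree G v ≡ d → h + h ≈ d · h + 𝟙 (d ℕₚ.≟ 1) · R →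
                  (degree G v ≡ 1 × h ≈ R) ⊎ degree G v ≡ 2
          cases 0 deg≡0 _  = contradiction deg≡0 (degree≢0 v v≢r)
          cases 1 deg≡1 eq = inj₁ (deg≡1 , ≈-shift eq
            (solve 2 (λ h r → ((h ⊞ 𝟎) ⊞ (r ⊞ 𝟎)) ⊟ (h ⊞ h) ⊜ r ⊟ h) ≈-refl h R))
          cases 2 deg≡2 _  = inj₂ deg≡2
          -- With three or more ends the surplus `h + k · h` would have to vanish, although `h` is
          -- positive.
          cases (suc (suc (suc k))) _ eq = contradiction (height-positive v v≢r)
            (≤⇒≯ (≤-shift (+-mono-≤ (·-nonneg k (height-nonneg v)) (≤-reflexive (≈-sym eq)))
              (solve 2 (λ h x → (x ⊞ (h ⊞ h)) ⊟ (𝟎 ⊞ ((h ⊞ (h ⊞ (h ⊞ x))) ⊞ 𝟎)) ⊜ 𝟎 ⊟ h) ≈-refl h (k · h))))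

        -- The root has height zero, so equality in `vertex-≤` at degree one would make `R` vanish,
        -- whereas the edge found at the root makes `R` positive.
        root-not-leaf : ¬ IsLeaf G root
        root-not-leaf deg≡1 with sum≢0⇒ (endsAt G root)
          (λ eq → contradiction (trans (sym deg≡1) (trans (degree≡sum G root) eq)) λ ())
        ... | e , _ = cases (degree G root) deg≡1 (vertex-≈ root)
          where
          h = height root
          cases : ∀ d → d ≡ 1 → ¬ h + h ≈ d · h + 𝟙 (d ℕₚ.≟ 1) · R
          cases _ refl eq = proj₂ (edge⇒0<R e) (≈-trans (≈-sym height-root)
            (≈-shift eq (solve 2 (λ h r → ((h ⊞ 𝟎) ⊞ (r ⊞ 𝟎)) ⊟ (h ⊞ h) ⊜ r ⊟ h) ≈-refl h R)))

-- Recognising the star when no vertex other than the root has degree two.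

module StarShaped {a : Level} (em : ExcludedMiddle a) (ℝ : RealNumbers a) where

  open Potentials em ℝ public

  module _ {n m : ℕ} (s t : Vector (Fin (suc n)) m) (l : Vector Carrier m) {R : Carrier} where

    open Extremal s t l

    module _ (P : Potential G R) (extremal : totalLength G ≈ (2 ℕ.* cyc G ℕ.+ leafCount G) · R)
             (no-degree-2 : ∀ v → v ≢ Potential.root P → degree G v ≢ 2) where

      open Potential P

      isLeaf : ∀ v → v ≢ root → degree G v ≡ 1 × height v ≈ R
      isLeaf v v≢r =
        [ id , (λ deg≡2 → contradiction deg≡2 (no-degree-2 v v≢r)) ] (degree-one-or-two P extremal v v≢r)

      -- All vertices other than the root have height `R`, and a parent end is strictly lower than
      -- its child.
      parentEnd≡root : ∀ i → parentEnd P i ≡ root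
      parentEnd≡root i = decidable-stable (parentEnd P i ≟ᶠ root) λ w≢r →
        ≤⇒≯ (≤-reflexive (≈-trans (proj₂ (isLeaf (vertexAt P i) (vertexAt≢root P i)))
                                  (≈-sym (proj₂ (isLeaf (parentEnd P i) w≢r)))))
          (parent-higher (parent-height P i))

      leafEdge-Joins : ∀ i → Joins G (parentEdge P i) root (vertexAt P i)
      leafEdge-Joins i = subst (λ w → Joins G (parentEdge P i) w (vertexAt P i))
        (parentEnd≡root i) (Joins-sym {G} (parent-Joins P i))

      leafEdge-length : ∀ i → l (parentEdge P i) ≈ R
      leafEdge-length i = begin
        l (parentEdge P i)                            ≈⟨ +-identityˡ _ ⟨
        0# + l (parentEdge P i)                       ≈⟨ +-congʳ height-root ⟨
        height root + l (parentEdge P i)              ≈⟨ +-congʳ (≈-reflexive (cong height (parentEnd≡root i))) ⟨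
        height (parentEnd P i) + l (parentEdge P i)   ≈⟨ parent-height P i ⟨
        height (vertexAt P i)                         ≈⟨ proj₂ (isLeaf (vertexAt P i) (vertexAt≢root P i)) ⟩
        R                                             ∎
        where open SetoidReasoning setoid

      -- A vertex other than the root has degree one, and that single edge end already belongs to
      -- its parent edge.
      otherEdge-ends : ∀ e → (∀ i → parentEdge P i ≢ e) → source G e ≡ root × target G e ≡ root
      otherEdge-ends e ∉ =
          at-root (s e) (λ i eq → proj₁ (avoids i) (sym eq))
        , at-root (t e) (λ i eq → proj₂ (avoids i) (sym eq))
        where
        avoids : ∀ i → source G e ≢ vertexAt P i × target G e ≢ vertexAt P i
        avoids i = endsAt≡0⇒ G (vertexAt P i) e (proj₂ (sum-only (endsAt G (vertexAt P i))
          (trans (sym (degree≡sum G (vertexAt P i))) (proj₁ (isLeaf (vertexAt P i) (vertexAt≢root P i))))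
          (parentEdge P i) (λ eq → contradiction (trans (sym (endsAt-parent P i)) eq) λ ()))
          e (λ e≡p → ∉ i (sym e≡p)))
        at-root : ∀ v → (∀ i → vertexAt P i ≢ v) → v ≡ root
        at-root v ∉ = sym (decidable-stable (root ≟ᶠ v) λ r≢v → ∉ (punchOut r≢v) (punchIn-punchOut r≢v))

      otherEdge-length : ∀ e → (∀ i → parentEdge P i ≢ e) → l e ≈ 2 · R
      otherEdge-length e ∉ = begin
        l e                                         ≈⟨ solve 1 (λ l → l ⊜ (𝟎 ⊞ 𝟎) ⊞ l) ≈-refl (l e) ⟩
        (0# + 0#) + l e                             ≈⟨ +-congʳ (+-cong (at-root (proj₁ ends)) (at-root (proj₂ ends))) ⟨
        peak e                                      ≈⟨ peak-maximal P extremal e ∉ ⟩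
        R + R                                       ≈⟨ +-congˡ (+-identityʳ R) ⟨
        2 · R                                       ∎
        where
        open SetoidReasoning setoid
        ends = otherEdge-ends e ∉
        at-root : ∀ {v} → v ≡ root → height v ≈ 0#
        at-root refl = height-root

      private
        enumeration = extend-injection (parentEdge P) (parentEdge-injective P)
        r = proj₁ enumeration
        σ = proj₁ (proj₂ enumeration)
        -- Sends the centre to the root and the leaf `suc i` to `vertexAt P i`, whose parent edge is
        -- the `i`-th edge listed by `σ`.
        π = Perm.insert zero root Perm.id

        -- Pairs the branch taken by `splitAt`, on which the `_++_` in `star` computes, with the
        -- role of the edge in `G`.
        data Kind (e : Fin (n ℕ.+ r)) : Set where
          toLeaf : ∀ i → splitAt n e ≡ inj₁ i → σ ⟨$⟩ʳ e ≡ parentEdge P i → Kind e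
          loop   : ∀ j → splitAt n e ≡ inj₂ j → (∀ i → parentEdge P i ≢ σ ⟨$⟩ʳ e) → Kind e

        kind : ∀ e → Kind e
        kind e = by-split (splitAt n e) refl
          where
          by-split : ∀ x → splitAt n e ≡ x → Kind e
          by-split (inj₁ i) eq = toLeaf i eq
            (trans (cong (σ ⟨$⟩ʳ_) (sym (splitAt⁻¹-↑ˡ eq))) (proj₂ (proj₂ enumeration) i))
          by-split (inj₂ j) eq = loop j eq λ i p≡σe → contradiction
            (trans (sym (splitAt-↑ˡ n i r)) (trans (cong (splitAt n) (i≡e i p≡σe)) eq)) λ ()
            where
            i≡e : ∀ i → parentEdge P i ≡ σ ⟨$⟩ʳ e → i ↑ˡ r ≡ e
            i≡e i p≡σe = trans (sym (Perm.inverseˡ σ))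
              (trans (cong (σ ⟨$⟩ˡ_) (trans (proj₂ (proj₂ enumeration) i) p≡σe)) (Perm.inverseˡ σ))

        π-zero : π ⟨$⟩ʳ zero ≡ root
        π-zero = insert-self zero root Perm.id

      star≅ : star n r R ≅ G
      star≅ = record
        { onVertices     = π
        ; onEdges        = σ
        ; len-preserved  = λ e → lengths e (kind e)
        ; ends-preserved = λ e → ends e (kind e)
        }
        where
        lengths : ∀ e → Kind e → len G (σ ⟨$⟩ʳ e) ≈ len (star n r R) e
        lengths e (toLeaf i eq σe≡) = ≈-trans (≈-reflexive (cong l σe≡))
          (≈-trans (leafEdge-length i) (≈-reflexive (cong [ const R , const (2 · R) ] (sym eq))))
        lengths e (loop j eq ∉) = ≈-trans (otherEdge-length (σ ⟨$⟩ʳ e) ∉)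
          (≈-reflexive (cong [ const R , const (2 · R) ] (sym eq)))
        ends : ∀ e → Kind e → Joins G (σ ⟨$⟩ʳ e) (π ⟨$⟩ʳ zero) (π ⟨$⟩ʳ target (star n r R) e)
        ends e (toLeaf i eq σe≡) = subst₂ (λ u v → Joins G (σ ⟨$⟩ʳ e) u v) (sym π-zero)
          (sym (trans (cong (λ x → π ⟨$⟩ʳ [ suc , const zero ] x) eq) (Perm.insert-punchIn zero root Perm.id i)))
          (subst (λ f → Joins G f root (vertexAt P i)) (sym σe≡) (leafEdge-Joins i))
        ends e (loop j eq ∉) = subst₂ (λ u v → Joins G (σ ⟨$⟩ʳ e) u v) (sym π-zero)
          (sym (trans (cong (λ x → π ⟨$⟩ʳ [ suc , const zero ] x) eq) π-zero))
          (inj₁ (otherEdge-ends (σ ⟨$⟩ʳ e) ∉))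

      leafCount≡ : leafCount G ≡ n
      leafCount≡ = trans (leafCount≡sum G) (trans (ℕ∑.sum-remove {i = root} (leaf P))
        (cong₂ ℕ._+_ (𝟙-no (degree G root ℕₚ.≟ 1) (root-not-leaf P extremal))
          (sum-ones _ λ i → 𝟙-yes (degree G (vertexAt P i) ℕₚ.≟ 1) (proj₁ (isLeaf (vertexAt P i) (vertexAt≢root P i))))))

      cyc≡ : cyc G ≡ r
      cyc≡ = ℕₚ.+-cancelʳ-≡ n (cyc G) r (trans (sym (edges≡ P)) (trans (sym (Perm.↔⇒≡ σ)) (ℕₚ.+-comm n r)))

      isStar : IsStar G R
      isStar = subst₂ (λ k c → G ∼ star k c R × ¬ IsLeaf (star k c R) zero) (sym leafCount≡) (sym cyc≡)
        ( bwd (relabel star≅) Star.◅ Star.ε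
        , λ leaf-zero → root-not-leaf P extremal
            (trans (cong (degree G) (sym π-zero)) (trans (degree-≅ star≅ zero) leaf-zero)) )

-- Transport of potentials along isomorphisms and mergers.

module Contractions {a : Level} (em : ExcludedMiddle a) (ℝ : RealNumbers a) where

  open StarShaped em ℝ public

  endsAt≡1⇒ : ∀ G v e → endsAt G v e ≡ 1 → ∃ λ x → Joins G e v x × x ≢ v
  endsAt≡1⇒ G v e = cases (source G e ≟ᶠ v) (target G e ≟ᶠ v)
    where
    cases : (s? : Dec (source G e ≡ v)) (t? : Dec (target G e ≡ v)) →
            𝟙 s? ℕ.+ 𝟙 t? ≡ 1 → ∃ λ x → Joins G e v x × x ≢ v
    cases (yes s≡v) (no t≢v)  _ = target G e , inj₁ (s≡v , refl) , t≢v
    cases (no s≢v)  (yes t≡v) _ = source G e , inj₂ (refl , t≡v) , s≢v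
    cases (yes _)   (yes _)   ()
    cases (no _)    (no _)    ()

  module _ {G H : WeightedGraph} where

    -- Allows the ends of an edge to be named in whichever order is convenient, while `_≅_` asks for
    -- source and target.
    Joins-map : ∀ {f : Fin (vertexCount G) → Fin (vertexCount H)} {e e′ v w} →
                Joins G e v w → Joins H e′ (f v) (f w) →
                Joins H e′ (f (source G e)) (f (target G e))
    Joins-map (inj₁ (refl , refl)) j = j
    Joins-map (inj₂ (refl , refl)) j = Joins-sym {H} j

    Joins-map⁻ : ∀ {f : Fin (vertexCount G) → Fin (vertexCount H)} {e e′ v w} →
                 Joins G e v w → Joins H e′ (f (source G e)) (f (target G e)) →
                 Joins H e′ (f v) (f w)
    Joins-map⁻ (inj₁ (refl , refl)) j = j
    Joins-map⁻ (inj₂ (refl , refl)) j = Joins-sym {H} j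

    Potential-≅ : ∀ {R} → G ≅ H → Potential G R → Potential H R
    Potential-≅ {R} G≅H P = record
      { root          = φ root
      ; height        = h
      ; 0≤R           = 0≤R
      ; len-positive  = λ e → <-≤-trans (len-positive (ψ⁻¹ e)) (≤-reflexive (≈-sym (len-ψ⁻¹ e)))
      ; height-root   = ≈-trans (h-φ root) height-root
      ; height-nonneg = λ v → height-nonneg (φ⁻¹ v)
      ; parent        = λ v v≢ → parent-φ⁻¹ v (parent (φ⁻¹ v) (λ eq → v≢ (trans (sym (Perm.inverseʳ onVertices)) (cong φ eq))))
      ; peak-≤        = λ e → ≤-trans (≤-reflexive (peak-ψ⁻¹ e)) (peak-≤ (ψ⁻¹ e))
      }
      where
      open _≅_ G≅H
      open Potential P
      φ⁻¹ = onVertices ⟨$⟩ˡ_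
      ψ⁻¹ = onEdges ⟨$⟩ˡ_
      h : Fin (vertexCount H) → Carrier
      h v = height (φ⁻¹ v)
      h-φ : ∀ v → h (φ v) ≈ height v
      h-φ v = ≈-reflexive (cong height (Perm.inverseˡ onVertices))
      len-ψ⁻¹ : ∀ e → len H e ≈ len G (ψ⁻¹ e)
      len-ψ⁻¹ e = ≈-trans (≈-reflexive (cong (len H) (sym (Perm.inverseʳ onEdges)))) (len-preserved (ψ⁻¹ e))
      parent-φ⁻¹ : ∀ v → (∃ λ e → ∃ λ w → Joins G e (φ⁻¹ v) w × height (φ⁻¹ v) ≈ height w + len G e) →
                   ∃ λ e → ∃ λ w → Joins H e v w × h v ≈ h w + len H e
      parent-φ⁻¹ v (e , w , j , eq) = ψ e , φ w
        , subst (λ x → Joins H (ψ e) x (φ w)) (Perm.inverseʳ onVertices) (Joins-map⁻ {f = φ} j (ends-preserved e))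
        , ≈-trans eq (+-cong (≈-sym (h-φ w)) (≈-sym (len-preserved e)))
      ends-ψ⁻¹ : ∀ e → Joins H e (φ (source G (ψ⁻¹ e))) (φ (target G (ψ⁻¹ e)))
      ends-ψ⁻¹ e = subst (λ e′ → Joins H e′ (φ (source G (ψ⁻¹ e))) (φ (target G (ψ⁻¹ e))))
        (Perm.inverseʳ onEdges) (ends-preserved (ψ⁻¹ e))
      ends-height : ∀ {e v w} → Joins H e v w → h (source H e) + h (target H e) ≈ h v + h w
      ends-height (inj₁ (refl , refl)) = ≈-refl
      ends-height (inj₂ (refl , refl)) = +-comm _ _
      peak-ψ⁻¹ : ∀ e → (h (source H e) + h (target H e)) + len H e ≈ peak (ψ⁻¹ e)
      peak-ψ⁻¹ e = +-cong (≈-trans (ends-height (ends-ψ⁻¹ e)) (+-cong (h-φ _) (h-φ _))) (len-ψ⁻¹ e)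

  module _ (H : WeightedGraph) (e : Fin (edgeCount H)) {b c : Carrier} (b+c≈len : b + c ≈ len H e) where

    private
      S = split H e b c

    split-target : target S (suc e) ≡ zero
    split-target = Vectorₚ.updateAt-updates e (Fin.suc ∘ target H)

    split-target-≢ : ∀ {j} → j ≢ e → target S (suc j) ≡ suc (target H j)
    split-target-≢ {j} j≢e = Vectorₚ.updateAt-minimal j e (Fin.suc ∘ target H) j≢e

    split-len : len S (suc e) ≡ b
    split-len = Vectorₚ.updateAt-updates e (len H)

    split-len-≢ : ∀ {j} → j ≢ e → len S (suc j) ≡ len H j
    split-len-≢ {j} j≢e = Vectorₚ.updateAt-minimal j e (len H) j≢e

    -- Heights are restricted to the old vertices. The cut vertex hangs from one end of `e`, say
    -- `s`; a vertex hanging from the cut vertex can then only be `t`, and it hangs from `s` through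
    -- the whole of `e`. The peak of `e` equals that of the part away from the parent of the cut
    -- vertex, here the part at `t`.
    Potential-unsplit : ∀ {R} (P : Potential S R) → Potential.root P ≢ zero → Potential H R
    Potential-unsplit {R} P root≢0 = record
      { root          = u
      ; height        = h
      ; 0≤R           = 0≤R
      ; len-positive  = positive
      ; height-root   = ≈-trans (≈-reflexive (cong height suc-u)) height-root
      ; height-nonneg = λ i → height-nonneg (suc i)
      ; parent        = λ i i≢u → parent′ i (parent (suc i) (λ eq → i≢u (suc-injective (trans eq (sym suc-u)))))
      ; peak-≤        = peaks
      }
      where
      open Potential P
      h : Fin (vertexCount H) → Carrier
      h i = height (suc i)
      u : Fin (vertexCount H)
      u = punchOut (root≢0 ∘ sym)
      suc-u : suc u ≡ root
      suc-u = punchIn-punchOut (root≢0 ∘ sym)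
      s = source H e
      t = target H e

      positive : ∀ j → 0# < len H j
      positive j = cases (j ≟ᶠ e)
        where
        cases : Dec (j ≡ e) → 0# < len H j
        cases (yes refl) = <-≤-trans (len-positive zero) (≤-shift (proj₁ (len-positive (suc e)))
          (≈-trans (+-congʳ (≈-reflexive split-len)) (≈-trans
            (solve 2 (λ b c → b ⊟ 𝟎 ⊜ (b ⊞ c) ⊟ c) ≈-refl b c) (+-congʳ b+c≈len))))
        cases (no j≢e) = <-≤-trans (len-positive (suc j)) (≤-reflexive (≈-reflexive (split-len-≢ j≢e)))

      cut-height : height zero ≈ h s + b ⊎ height zero ≈ h t + c
      cut-height = cases (parent zero (root≢0 ∘ sym))
        where
        cases : (∃ λ k → ∃ λ w → Joins S k zero w × height zero ≈ height w + len S k) →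
                height zero ≈ h s + b ⊎ height zero ≈ h t + c
        cases (zero , w , inj₁ (_ , refl) , eq) = inj₂ eq
        cases (zero , w , inj₂ (_ , ()) , eq)
        cases (suc j , w , inj₁ (() , _) , eq)
        cases (suc j , w , inj₂ (refl , t≡0) , eq) = at-e (j ≟ᶠ e)
          where
          at-e : Dec (j ≡ e) → height zero ≈ h s + b ⊎ height zero ≈ h t + c
          at-e (yes refl) = inj₁ (≈-trans eq (+-congˡ (≈-reflexive split-len)))
          at-e (no j≢e) = contradiction (trans (sym (split-target-≢ j≢e)) t≡0) λ ()

      -- Rules out that the cut vertex and one of its neighbours are parents of each other.
      cycle : ∀ {x y d d′} → 0# < d → 0# < d′ → x ≈ y + d → ¬ y ≈ x + d′
      cycle {x} {y} {d} {d′} 0<d 0<d′ x≈ y≈ = ≤⇒≯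
        (≤-shift (≤-reflexive (≈-sym (+-cong x≈ y≈)))
          (solve 4 (λ x y d d′ → (x ⊞ y) ⊟ ((y ⊞ d) ⊞ (x ⊞ d′)) ⊜ 𝟎 ⊟ (d ⊞ d′)) ≈-refl x y d d′))
        (<-≤-trans 0<d (≤-shift (proj₁ 0<d′) (solve 2 (λ d d′ → d′ ⊟ 𝟎 ⊜ (d ⊞ d′) ⊟ d) ≈-refl d d′)))

      0<b : 0# < b
      0<b = <-≤-trans (len-positive (suc e)) (≤-reflexive (≈-reflexive split-len))

      parent′ : ∀ i → (∃ λ k → ∃ λ w → Joins S k (suc i) w × h i ≈ height w + len S k) →
                ∃ λ j → ∃ λ w → Joins H j i w × h i ≈ h w + len H j
      parent′ i (zero , w , inj₁ (() , _) , eq)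
      parent′ i (zero , w , inj₂ (refl , refl) , eq) = e , s , inj₂ (refl , refl) ,
        [ (λ h0≈ → ≈-trans eq (≈-trans (+-congʳ h0≈) (≈-trans (+-assoc _ _ _) (+-congˡ b+c≈len))))
        , (λ h0≈ → contradiction h0≈ (cycle (len-positive zero) (len-positive zero) eq)) ]′ cut-height
      parent′ i (suc j , w , joins , eq) = at-e (j ≟ᶠ e)
        where
        at-e : Dec (j ≡ e) → ∃ λ j → ∃ λ w → Joins H j i w × h i ≈ h w + len H j
        at-e (yes refl) = e , t , inj₁ (s≡i joins , refl) , upwards joins
          where
          s≡i : Joins S (suc e) (suc i) w → source H e ≡ i
          s≡i (inj₁ (eq , _)) = suc-injective eq
          s≡i (inj₂ (_ , eq)) = contradiction (trans (sym split-target) eq) λ ()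
          upwards : Joins S (suc e) (suc i) w → h i ≈ h t + len H e
          upwards (inj₂ (_ , eq)) = contradiction (trans (sym split-target) eq) λ ()
          upwards (inj₁ (refl , refl)) =
            [ (λ h0≈ → contradiction h0≈ (cycle 0<b 0<b up))
            , (λ h0≈ → ≈-trans up (≈-trans (+-congʳ h0≈) (≈-trans (+-assoc _ _ _) (+-congˡ (≈-trans (+-comm c b) b+c≈len))))) ]′
            cut-height
            where
            up : h i ≈ height zero + b
            up = ≈-trans eq (+-cong (≈-reflexive (cong height split-target)) (≈-reflexive split-len))
        at-e (no j≢e) = via joins
          where
          via : Joins S (suc j) (suc i) w → ∃ λ j → ∃ λ w → Joins H j i w × h i ≈ h w + len H j
          via (inj₁ (s≡i , t≡w)) = j , target H j , inj₁ (suc-injective s≡i , refl)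
            , ≈-trans eq (+-cong (≈-reflexive (cong height (trans (sym t≡w) (split-target-≢ j≢e)))) (≈-reflexive (split-len-≢ j≢e)))
          via (inj₂ (s≡w , t≡i)) = j , source H j , inj₂ (refl , suc-injective (trans (sym (split-target-≢ j≢e)) t≡i))
            , ≈-trans eq (+-cong (≈-reflexive (cong height (sym s≡w))) (≈-reflexive (split-len-≢ j≢e)))

      peaks : ∀ j → (h (source H j) + h (target H j)) + len H j ≤ R + R
      peaks j = at-e (j ≟ᶠ e)
        where
        at-e : Dec (j ≡ e) → (h (source H j) + h (target H j)) + len H j ≤ R + R
        at-e (yes refl) = [ below-source , below-target ]′ cut-height
          where
          open SetoidReasoning setoid
          below-source : height zero ≈ h s + b → (h s + h t) + len H e ≤ R + R
          below-source h0≈ = ≤-trans (≤-reflexive (begin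
            (h s + h t) + len H e    ≈⟨ +-congˡ b+c≈len ⟨
            (h s + h t) + (b + c)    ≈⟨ solve 4 (λ s t b c → (s ⊞ t) ⊞ (b ⊞ c) ⊜ ((s ⊞ b) ⊞ t) ⊞ c) ≈-refl (h s) (h t) b c ⟩
            ((h s + b) + h t) + c    ≈⟨ +-congʳ (+-congʳ h0≈) ⟨
            (height zero + h t) + c  ∎)) (peak-≤ zero)
          below-target : height zero ≈ h t + c → (h s + h t) + len H e ≤ R + R
          below-target h0≈ = ≤-trans (≤-reflexive (begin
            (h s + h t) + len H e    ≈⟨ +-congˡ b+c≈len ⟨
            (h s + h t) + (b + c)    ≈⟨ solve 4 (λ s t b c → (s ⊞ t) ⊞ (b ⊞ c) ⊜ (s ⊞ (t ⊞ c)) ⊞ b) ≈-refl (h s) (h t) b c ⟩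
            (h s + (h t + c)) + b    ≈⟨ +-congʳ (+-congˡ h0≈) ⟨
            (h s + height zero) + b
              ≈⟨ +-cong (+-congˡ (≈-reflexive (cong height split-target))) (≈-reflexive split-len) ⟨
            peak (suc e)             ∎)) (peak-≤ (suc e))
        at-e (no j≢e) = ≤-trans (≤-reflexive (≈-sym
          (+-cong (+-congˡ (≈-reflexive (cong height (split-target-≢ j≢e)))) (≈-reflexive (split-len-≢ j≢e)))))
          (peak-≤ (suc j))

-- Removing vertices of degree two.

module DegreeTwo {a : Level} (em : ExcludedMiddle a) (ℝ : RealNumbers a) where

  open Contractions em ℝ public

  module _ {n m : ℕ} (s t : Vector (Fin (suc n)) (suc m)) (l : Vector Carrier (suc m)) where

    open Extremal s t l using (G)

    -- `Step` only inserts vertices, so `v` is removed by constructing the merged graph `H` and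
    -- exhibiting `G` as a subdivision of it up to isomorphism. The neighbours `w` and `x` may
    -- coincide; the merged edge is then a loop.
    module Merge {v w x : Fin (suc n)} {e₁ e₂ : Fin (suc m)} (e₂≢e₁ : e₂ ≢ e₁)
      (joins₁ : Joins G e₁ w v) (w≢v : w ≢ v) (joins₂ : Joins G e₂ v x) (x≢v : x ≢ v)
      (others : ∀ e → e ≢ e₁ → e ≢ e₂ → source G e ≢ v × target G e ≢ v) where

      π : Permutation (suc n) (suc n)
      π = Perm.insert v zero Perm.id

      π-v : π ⟨$⟩ʳ v ≡ zero
      π-v = insert-self v zero Perm.id

      -- The value at v is irrelevant.
      κ : Fin (suc n) → Fin n
      κ y = lower (π ⟨$⟩ʳ y)
        where
        lower : Fin (suc n) → Fin n
        lower zero    = punchOut (w≢v ∘ sym)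
        lower (suc i) = i

      π-κ : ∀ {y} → y ≢ v → π ⟨$⟩ʳ y ≡ suc (κ y)
      π-κ {y} y≢v with π ⟨$⟩ʳ y in eq
      ... | suc i = refl
      ... | zero  = contradiction
        (trans (sym (Perm.inverseˡ π)) (trans (cong (π ⟨$⟩ˡ_) (trans eq (sym π-v))) (Perm.inverseˡ π))) y≢v

      e₁′ : Fin m
      e₁′ = punchOut e₂≢e₁

      H : WeightedGraph
      H = record
        { vertexCount = n
        ; edgeCount   = m
        -- The merged edge runs from `w` to `x`, so that `split` returns `e₁` as its shortened edge
        -- and `e₂` as its new edge zero.
        ; source      = updateAt (κ ∘ s ∘ punchIn e₂) e₁′ (const (κ w))
        ; target      = updateAt (κ ∘ t ∘ punchIn e₂) e₁′ (const (κ x))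
        ; len         = updateAt (l ∘ punchIn e₂) e₁′ (const (l e₁ + l e₂))
        }

      S : WeightedGraph
      S = split H e₁′ (l e₁) (l e₂)

      len-e₁′ : l e₁ + l e₂ ≈ len H e₁′
      len-e₁′ = ≈-reflexive (sym (Vectorₚ.updateAt-updates e₁′ (l ∘ punchIn e₂)))

      ρ : Permutation (suc m) (suc m)
      ρ = Perm.insert e₂ zero Perm.id

      data Role (e : Fin (suc m)) : Set where
        first  : e ≡ e₁ → ρ ⟨$⟩ʳ e ≡ suc e₁′ → Role e
        second : e ≡ e₂ → ρ ⟨$⟩ʳ e ≡ zero → Role e
        other  : ∀ j → j ≢ e₁′ → punchIn e₂ j ≡ e → ρ ⟨$⟩ʳ e ≡ suc j →
                 source G e ≢ v → target G e ≢ v → Role e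

      ρ-punchIn : ∀ j {e} → punchIn e₂ j ≡ e → ρ ⟨$⟩ʳ e ≡ suc j
      ρ-punchIn j refl = Perm.insert-punchIn e₂ zero Perm.id j

      role : ∀ e → Role e
      role e = decide (e ≟ᶠ e₁) (e₂ ≟ᶠ e)
        where
        decide : Dec (e ≡ e₁) → Dec (e₂ ≡ e) → Role e
        decide (yes refl) _ = first refl (ρ-punchIn e₁′ (punchIn-punchOut e₂≢e₁))
        decide (no _) (yes refl) = second refl (insert-self e₂ zero Perm.id)
        decide (no e≢e₁) (no e₂≢e) = other (punchOut e₂≢e)
          (λ eq → e≢e₁ (trans (sym (punchIn-punchOut e₂≢e)) (trans (cong (punchIn e₂) eq) (punchIn-punchOut e₂≢e₁))))
          (punchIn-punchOut e₂≢e) (ρ-punchIn _ (punchIn-punchOut e₂≢e))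
          (proj₁ (others e e≢e₁ (e₂≢e ∘ sym))) (proj₂ (others e e≢e₁ (e₂≢e ∘ sym)))

      ≅-split : G ≅ S
      ≅-split = record
        { onVertices     = π
        ; onEdges        = ρ
        ; len-preserved  = λ e → lengths e (role e)
        ; ends-preserved = λ e → ends e (role e)
        }
        where
        lengths : ∀ e → Role e → len S (ρ ⟨$⟩ʳ e) ≈ len G e
        lengths e (first refl ρe≡) = ≈-reflexive (trans (cong (len S) ρe≡) (split-len H e₁′ len-e₁′))
        lengths e (second refl ρe≡) = ≈-reflexive (cong (len S) ρe≡)
        lengths e (other j j≢ refl ρe≡ _ _) = ≈-reflexive (trans (cong (len S) ρe≡)
          (trans (split-len-≢ H e₁′ len-e₁′ j≢) (Vectorₚ.updateAt-minimal j e₁′ (l ∘ punchIn e₂) j≢)))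
        ends : ∀ e → Role e → Joins S (ρ ⟨$⟩ʳ e) (π ⟨$⟩ʳ source G e) (π ⟨$⟩ʳ target G e)
        ends e (first refl ρe≡) = Joins-map {G} {S} {f = π ⟨$⟩ʳ_} {e′ = ρ ⟨$⟩ʳ e} joins₁
          (subst (λ k → Joins S k (π ⟨$⟩ʳ w) (π ⟨$⟩ʳ v)) (sym ρe≡) (inj₁
            ( trans (cong suc (Vectorₚ.updateAt-updates e₁′ (κ ∘ s ∘ punchIn e₂))) (sym (π-κ w≢v))
            , trans (split-target H e₁′ len-e₁′) (sym π-v) )))
        ends e (second refl ρe≡) = Joins-map {G} {S} {f = π ⟨$⟩ʳ_} {e′ = ρ ⟨$⟩ʳ e} joins₂
          (subst (λ k → Joins S k (π ⟨$⟩ʳ v) (π ⟨$⟩ʳ x)) (sym ρe≡) (inj₁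
            ( sym π-v
            , trans (cong suc (Vectorₚ.updateAt-updates e₁′ (κ ∘ t ∘ punchIn e₂))) (sym (π-κ x≢v)) )))
        ends e (other j j≢ refl ρe≡ s≢v t≢v) =
          subst (λ k → Joins S k (π ⟨$⟩ʳ source G e) (π ⟨$⟩ʳ target G e)) (sym ρe≡) (inj₁
            ( trans (cong suc (Vectorₚ.updateAt-minimal j e₁′ (κ ∘ s ∘ punchIn e₂) j≢)) (sym (π-κ s≢v))
            , trans (split-target-≢ H e₁′ len-e₁′ j≢)
                (trans (cong suc (Vectorₚ.updateAt-minimal j e₁′ (κ ∘ t ∘ punchIn e₂) j≢)) (sym (π-κ t≢v))) ))

    record Reduction (R : Carrier) : Set (Level.suc a) where
      field
        reduced         : WeightedGraph
        fewer           : vertexCount reduced ≡ n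
        equivalent      : G ∼ reduced
        potential       : Potential reduced R
        same-leafCount  : leafCount reduced ≡ leafCount G
        same-cyc        : cyc reduced ≡ cyc G

    -- The parent edge uses just one of the two edge ends at `v`, as its other end is strictly
    -- lower. Hence exactly one other edge meets `v`, again with a single end, and the two edges can
    -- be merged.
    reduce : ∀ {R} (P : Potential G R) v → v ≢ Potential.root P → degree G v ≡ 2 → Reduction R
    reduce {R} P v v≢r deg≡2 = from-parent (parent v v≢r)
      where
      open Potential P
      from-parent : (∃ λ e → ∃ λ w → Joins G e v w × height v ≈ height w + len G e) → Reduction R
      from-parent (e₁ , w , joins₁ , eq) = from-other (sum≢0⇒ rest (λ rest≡0 → 1≢0 (trans (sym Σrest) rest≡0)))
        where
        1≢0 : 1 ≢ 0
        1≢0 ()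
        w≢v : w ≢ v
        w≢v = parent-≢ eq
        rest : Fin m → ℕ
        rest j = endsAt G v (punchIn e₁ j)
        Σrest : ℕ∑.sum rest ≡ 1
        Σrest = ℕₚ.suc-injective (trans (cong (ℕ._+ ℕ∑.sum rest) (sym (Joins-endsAt {G} joins₁ w≢v)))
          (trans (sym (ℕ∑.sum-remove {i = e₁} (endsAt G v))) (trans (sym (degree≡sum G v)) deg≡2)))
        from-other : (∃ λ j → rest j ≢ 0) → Reduction R
        from-other (j , restⱼ≢0) = merge (endsAt≡1⇒ G v e₂ (proj₁ only))
          where
          e₂ = punchIn e₁ j
          only : rest j ≡ 1 × (∀ i → i ≢ j → rest i ≡ 0)
          only = sum-only rest Σrest j restⱼ≢0
          others : ∀ e → e ≢ e₁ → e ≢ e₂ → source G e ≢ v × target G e ≢ v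
          others e e≢e₁ e≢e₂ = endsAt≡0⇒ G v e (subst (λ e → endsAt G v e ≡ 0) (punchIn-punchOut (e≢e₁ ∘ sym))
            (proj₂ only (punchOut (e≢e₁ ∘ sym))
              (λ eq → e≢e₂ (trans (sym (punchIn-punchOut (e≢e₁ ∘ sym))) (cong (punchIn e₁) eq)))))
          merge : (∃ λ x → Joins G e₂ v x × x ≢ v) → Reduction R
          merge (x , joins₂ , x≢v) = record
            { reduced        = H
            ; fewer          = refl
            ; equivalent     = fwd (relabel ≅-split) Star.◅ bwd (subdivide {H} e₁′ (l e₁) (l e₂)
                                 (len-positive e₁) (len-positive e₂) len-e₁′) Star.◅ Star.ε
            ; potential      = Potential-unsplit H e₁′ len-e₁′ (Potential-≅ ≅-split P)
                                 (λ eq → v≢r (sym (φ-injective ≅-split (trans eq (sym π-v)))))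
            ; same-leafCount = trans (sym (leafCount-split H e₁′ (l e₁) (l e₂))) (leafCount-≅ ≅-split)
            -- `cyc` of a split graph computes to that of the graph itself, since both counts grow
            -- by one.
            ; same-cyc       = cyc-≅ ≅-split
            }
            where open Merge (punchInᵢ≢i e₁ j) (Joins-sym {G} joins₁) w≢v joins₂ x≢v others

  private
    -- Induction on the number of vertices, given through an equation because a reduction delivers
    -- its count only propositionally. Graphs are matched by their fields to meet the form of
    -- `Extremal`.
    star-of : ∀ n (G : WeightedGraph) → vertexCount G ≡ n → ∀ {R} → Potential G R →
              totalLength G ≈ (2 ℕ.* cyc G ℕ.+ leafCount G) · R → IsStar G R
    star-of zero G refl P _ = contradiction (Potential.root P) λ ()
    -- Without edges no vertex has a parent edge, so there is no vertex besides the root.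
    star-of (suc n) (record { edgeCount = zero ; source = s ; target = t ; len = l }) refl P extremal =
      StarShaped.isStar em ℝ s t l P extremal λ v v≢r → contradiction (proj₁ (Potential.parent P v v≢r)) λ ()
    star-of (suc n) G@(record { edgeCount = suc m ; source = s ; target = t ; len = l }) refl {R} P extremal =
      cases (any? (λ v → ¬? (v ≟ᶠ root) ×-dec (degree G v ℕₚ.≟ 2)))
      where
      open Potential P using (root)
      cases : Dec (∃ λ v → v ≢ root × degree G v ≡ 2) → IsStar G R
      cases (no ∄v) = StarShaped.isStar em ℝ s t l P extremal λ v v≢r deg≡2 → ∄v (v , v≢r , deg≡2)
      cases (yes (v , v≢r , deg≡2)) =
          EqClosure.transitive Step equivalent (subst₂ (λ k c → reduced ∼ star k c R) same-leafCount same-cyc (proj₁ rest))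
        , subst₂ (λ k c → ¬ IsLeaf (star k c R) zero) same-leafCount same-cyc (proj₂ rest)
        where
        open Reduction (reduce s t l P v v≢r deg≡2)
        rest : IsStar reduced R
        rest = star-of n reduced fewer potential (≈-trans (≈-sym (totalLength-∼ equivalent))
          (≈-trans extremal (×-congˡ (sym (cong₂ (λ c k → 2 ℕ.* c ℕ.+ k) same-cyc same-leafCount)))))

  extremal⇒star : ∀ {G R} → Potential G R →
                  totalLength G ≈ (2 ℕ.* cyc G ℕ.+ leafCount G) · R → IsStar G R
  extremal⇒star {G} = star-of (vertexCount G) G refl

-- Greatest solutions of difference constraints.

module DifferenceConstraints {a : Level} (em : ExcludedMiddle a) (ℝ : RealNumbers a) where

  open DegreeTwo em ℝ public

  -- The form of finiteness that raising a solution requires; it passes to disjoint sums, from which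
  -- the constraints are assembled.
  BoundedAway : Set → Set a
  BoundedAway I = (g : I → Carrier) → (∀ i → 0# < g i) → ∃ λ ε → 0# < ε × (∀ i → ε ≤ g i)

  minimum : ∀ {x y} → 0# < x → 0# < y → ∃ λ ε → 0# < ε × ε ≤ x × ε ≤ y
  minimum {x} {y} 0<x 0<y =
    [ (λ x≤y → x , 0<x , ≤-refl , x≤y) , (λ y≤x → y , 0<y , y≤x , ≤-refl) ]′ (total x y)

  boundedAway-Fin : ∀ k → BoundedAway (Fin k)
  boundedAway-Fin zero    g 0<g = 1# , (0≤1 , 0≉1) , λ ()
  boundedAway-Fin (suc k) g 0<g = combine (boundedAway-Fin k (g ∘ suc) (0<g ∘ suc))
    where
    combine : (∃ λ ε → 0# < ε × (∀ i → ε ≤ g (suc i))) → ∃ λ ε → 0# < ε × (∀ i → ε ≤ g i)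
    combine (ε , 0<ε , ε≤) with minimum (0<g zero) 0<ε
    ... | δ , 0<δ , δ≤g₀ , δ≤ε = δ , 0<δ , λ { zero → δ≤g₀ ; (suc i) → ≤-trans δ≤ε (ε≤ i) }

  boundedAway-⊎ : ∀ {I J} → BoundedAway I → BoundedAway J → BoundedAway (I ⊎ J)
  boundedAway-⊎ minᴵ minᴶ g 0<g
    with minᴵ (g ∘ inj₁) (0<g ∘ inj₁) | minᴶ (g ∘ inj₂) (0<g ∘ inj₂)
  ... | ε , 0<ε , ε≤ | ε′ , 0<ε′ , ε′≤ with minimum 0<ε 0<ε′
  ... | δ , 0<δ , δ≤ε , δ≤ε′ = δ , 0<δ , λ { (inj₁ i) → ≤-trans δ≤ε (ε≤ i) ; (inj₂ j) → ≤-trans δ≤ε′ (ε′≤ j) }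

  -- `nothing` stands for the origin of the distances, where every solution has the value zero.
  value : ∀ {n} → (Fin n → Carrier) → Maybe (Fin n) → Carrier
  value h nothing  = 0#
  value h (just w) = h w

  -- Shortest distances by duality: the greatest solution of the constraints
  -- h (to i) ≤ value h (from i) + cost i is tight at every vertex, since
  -- otherwise it could be raised there.
  module _ {n : ℕ} {I : Set} (to : I → Fin n) (from : I → Maybe (Fin n)) (cost : I → Carrier) where

    Feasible : (Fin n → Carrier) → Set a
    Feasible h = ∀ i → h (to i) ≤ value h (from i) + cost i

    Tight : (Fin n → Carrier) → Set a
    Tight f = ∀ v → ∃ λ i → to i ≡ v × f v ≈ value f (from i) + cost i

    module _ (boundedAway : BoundedAway I) (0≤cost : ∀ i → 0# ≤ cost i)
             (bounded : ∀ v → ∃ λ b → ∀ h → Feasible h → h v ≤ b) where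

      Attainable : Fin n → Carrier → Set a
      Attainable v r = ∃ λ h → Feasible h × r ≈ h v

      0-feasible : Feasible (const 0#)
      0-feasible i = ≤-trans (0≤cost i) (≤-reflexive (≈-trans (≈-sym (+-identityˡ _))
        (+-congʳ (value-0 (from i)))))
        where
        value-0 : ∀ u → 0# ≈ value {n} (const 0#) u
        value-0 nothing  = ≈-refl
        value-0 (just _) = ≈-refl

      supremum : ∀ v → ∃ λ s → s IsUpperBoundOf Attainable v × (∀ b → b IsUpperBoundOf Attainable v → s ≤ b)
      supremum v = complete (Attainable v) (0# , const 0# , 0-feasible , ≈-refl)
        (proj₁ (bounded v) , λ { r (h , feasible , r≈) → ≤-trans (≤-reflexive r≈) (proj₂ (bounded v) h feasible) })

      module _ (f : Fin n → Carrier) (upper : ∀ v → f v IsUpperBoundOf Attainable v)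
               (least : ∀ v b → b IsUpperBoundOf Attainable v → f v ≤ b) where

        dominates : ∀ h → Feasible h → ∀ v → h v ≤ f v
        dominates h feasible v = upper v (h v) (h , feasible , ≈-refl)

        value-mono : ∀ {g h : Fin n → Carrier} → (∀ w → g w ≤ h w) → ∀ u → value g u ≤ value h u
        value-mono g≤h nothing  = ≤-refl
        value-mono g≤h (just w) = g≤h w

        -- Each right side is monotone in the function, so the constraints survive pointwise
        -- suprema.
        f-feasible : Feasible f
        f-feasible i = least (to i) _ λ { r (h , feasible , r≈) → ≤-trans (≤-reflexive r≈)
          (≤-trans (feasible i) (+-monoˡ-≤ (cost i) (value-mono (dominates h feasible) (from i)))) }

        f-tight : Tight f
        f-tight v = decidable-stable em λ not-tight → raise (λ i to≡v eq → not-tight (i , to≡v , eq))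
          where
          raise : ¬ (∀ i → to i ≡ v → ¬ f v ≈ value f (from i) + cost i)
          raise not-tight = absurd (boundedAway (λ i → proj₁ (slack i)) (λ i → proj₁ (proj₂ (slack i))))
            where
            slack : ∀ i → ∃ λ ε → 0# < ε × (to i ≡ v → f v + ε ≤ value f (from i) + cost i)
            slack i = by (to i ≟ᶠ v)
              where
              by : Dec (to i ≡ v) → ∃ λ ε → 0# < ε × (to i ≡ v → f v + ε ≤ value f (from i) + cost i)
              -- A constraint at another vertex does not limit the raise at `v`, so any positive
              -- number serves.
              by (no to≢v)  = 1# , (0≤1 , 0≉1) , λ to≡v → contradiction to≡v to≢v
              by (yes refl) = (value f (from i) + cost i) - f v
                , <-shift (f-feasible i , not-tight i refl)
                    (solve 2 (λ x y → y ⊟ x ⊜ (y ⊟ x) ⊟ 𝟎) ≈-refl (f v) (value f (from i) + cost i))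
                , λ _ → ≤-reflexive (solve 2 (λ x y → x ⊞ (y ⊟ x) ⊜ y) ≈-refl (f v) (value f (from i) + cost i))
            absurd : ¬ (∃ λ ε → 0# < ε × (∀ i → ε ≤ proj₁ (slack i)))
            absurd (ε , 0<ε , ε≤) = ≤⇒≯
              (≤-shift (≤-trans (≤-reflexive (≈-sym (raised-v (v ≟ᶠ v)))) (dominates f⁺ f⁺-feasible v))
                (solve 2 (λ x ε → x ⊟ (x ⊞ ε) ⊜ 𝟎 ⊟ ε) ≈-refl (f v) ε)) 0<ε
              where
              raised : ∀ w → Dec (w ≡ v) → Carrier
              raised w (yes _) = f v + ε
              raised w (no _)  = f w
              f⁺ : Fin n → Carrier
              f⁺ w = raised w (w ≟ᶠ v)
              raised-v : (v≟v : Dec (v ≡ v)) → raised v v≟v ≈ f v + ε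
              raised-v (yes _)  = ≈-refl
              raised-v (no v≢v) = contradiction refl v≢v
              f≤raised : ∀ w d → f w ≤ raised w d
              f≤raised w (yes refl) = ≤-shift (proj₁ 0<ε) (solve 2 (λ x ε → ε ⊟ 𝟎 ⊜ (x ⊞ ε) ⊟ x) ≈-refl (f w) ε)
              f≤raised w (no _)     = ≤-refl
              f⁺-feasible : Feasible f⁺
              -- The right sides can only grow, so only constraints at `v` are at risk, and each of
              -- them has room `ε`.
              f⁺-feasible i = ≤-trans (raised-to (to i ≟ᶠ v))
                (+-monoˡ-≤ (cost i) (value-mono (λ w → f≤raised w (w ≟ᶠ v)) (from i)))
                where
                raised-to : ∀ d → raised (to i) d ≤ value f (from i) + cost i
                raised-to (yes to≡v) = ≤-trans (+-monoʳ-≤ (f v) (ε≤ i)) (proj₂ (proj₂ (slack i)) to≡v)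
                raised-to (no _)     = f-feasible i

      greatest-feasible : ∃ λ f → Feasible f × (∀ v → 0# ≤ f v) × Tight f
      greatest-feasible = f , f-feasible f upper least
        , (λ v → dominates f upper least (const 0#) 0-feasible v)
        , f-tight f upper least
        where
        f : Fin n → Carrier
        f v = proj₁ (supremum v)
        upper : ∀ v → f v IsUpperBoundOf Attainable v
        upper v = proj₁ (proj₂ (supremum v))
        least : ∀ v b → b IsUpperBoundOf Attainable v → f v ≤ b
        least v = proj₂ (proj₂ (supremum v))

-- Lower bounds for path lengths.

module Distances {a : Level} (em : ExcludedMiddle a) (ℝ : RealNumbers a) where

  open DifferenceConstraints em ℝ public

  module FromPoint (M : MetricGraph) (x₀ : Point (MetricGraph.graph M)) where

    G : WeightedGraph
    G = MetricGraph.graph M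

    private
      V E : Set
      V = Fin (vertexCount G)
      E = Fin (edgeCount G)
      s = source G
      t = target G
      l = len G

    0<l : ∀ e → 0# < l e
    0<l = MetricGraph.len-positive M

    -- A distance function is constrained along each edge, in both directions,
    -- and by x₀, at the two ends of its edge or twice at the vertex x₀.
    Constraint : Set
    Constraint = (E ⊎ E) ⊎ Fin 2

    pattern forward e  = inj₁ (inj₁ e)
    pattern backward e = inj₁ (inj₂ e)
    pattern initial i  = inj₂ i

    initialVertex : Point G → Fin 2 → V
    initialVertex (vertex u)   i       = u
    initialVertex (on e _ _ _) zero    = s e
    initialVertex (on e _ _ _) (suc _) = t e

    initialCost : Point G → Fin 2 → Carrier
    initialCost (vertex u)   i       = 0#
    initialCost (on e τ _ _) zero    = τ
    initialCost (on e τ _ _) (suc _) = l e - τ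

    to : Constraint → V
    to (forward e)  = t e
    to (backward e) = s e
    to (initial i)  = initialVertex x₀ i

    from : Constraint → Maybe V
    from (forward e)  = just (s e)
    from (backward e) = just (t e)
    from (initial i)  = nothing

    cost : Constraint → Carrier
    cost (forward e)  = l e
    cost (backward e) = l e
    cost (initial i)  = initialCost x₀ i

    -- r ≤ ∣ τ - τ₀ ∣ if x₀ lies on the edge j, at τ₀.
    Within : Point G → E → Carrier → Carrier → Set a
    Within (vertex _)    j τ r = Lift a ⊤
    Within (on e τ₀ _ _) j τ r = j ≡ e → (τ ≤ τ₀ → r ≤ τ₀ - τ) × (τ₀ ≤ τ → r ≤ τ - τ₀)

    within-mono : ∀ x {j τ r r′} → r′ ≤ r → Within x j τ r → Within x j τ r′
    within-mono (vertex _)   r′≤r w     = lift tt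
    within-mono (on _ _ _ _) r′≤r w j≡e =
      (λ τ≤ → ≤-trans r′≤r (proj₁ (w j≡e) τ≤)) , (λ ≤τ → ≤-trans r′≤r (proj₂ (w j≡e) ≤τ))

    -- Together with `within-back`, the triangle inequality for the distance to `τ₀` inside one
    -- edge; the cases are the possible positions relative to `τ₀`.
    within-forth : ∀ x {j σ τ r} → σ ≤ τ → Within x j τ r → Within x j σ (r - (τ - σ))
    within-forth (vertex _) σ≤τ w = lift tt
    within-forth (on _ τ₀ _ _) {j} {σ} {τ} {r} σ≤τ w j≡e =
        (λ σ≤τ₀ → [ (λ τ≤τ₀ → ≤-shift (+-mono-≤ (proj₁ (w j≡e) τ≤τ₀) (+-mono-≤ σ≤τ σ≤τ))
                      (solve 4 (λ σ τ τ₀ r → ((τ₀ ⊟ τ) ⊞ (τ ⊞ τ)) ⊟ (r ⊞ (σ ⊞ σ)) ⊜ (τ₀ ⊟ σ) ⊟ (r ⊟ (τ ⊟ σ))) ≈-refl σ τ τ₀ r))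
                  , (λ τ₀≤τ → ≤-shift (+-mono-≤ (proj₂ (w j≡e) τ₀≤τ) (+-mono-≤ σ≤τ₀ σ≤τ₀))
                      (solve 4 (λ σ τ τ₀ r → ((τ ⊟ τ₀) ⊞ (τ₀ ⊞ τ₀)) ⊟ (r ⊞ (σ ⊞ σ)) ⊜ (τ₀ ⊟ σ) ⊟ (r ⊟ (τ ⊟ σ))) ≈-refl σ τ τ₀ r))
                  ]′ (total τ τ₀))
      , (λ τ₀≤σ → ≤-shift (proj₂ (w j≡e) (≤-trans τ₀≤σ σ≤τ))
          (solve 4 (λ σ τ τ₀ r → (τ ⊟ τ₀) ⊟ r ⊜ (σ ⊟ τ₀) ⊟ (r ⊟ (τ ⊟ σ))) ≈-refl σ τ τ₀ r))

    within-back : ∀ x {j σ τ r} → σ ≤ τ → Within x j σ r → Within x j τ (r - (τ - σ))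
    within-back (vertex _) σ≤τ w = lift tt
    within-back (on _ τ₀ _ _) {j} {σ} {τ} {r} σ≤τ w j≡e =
        (λ τ≤τ₀ → ≤-shift (proj₁ (w j≡e) (≤-trans σ≤τ τ≤τ₀))
          (solve 4 (λ σ τ τ₀ r → (τ₀ ⊟ σ) ⊟ r ⊜ (τ₀ ⊟ τ) ⊟ (r ⊟ (τ ⊟ σ))) ≈-refl σ τ τ₀ r))
      , (λ τ₀≤τ → [ (λ σ≤τ₀ → ≤-shift (+-mono-≤ (proj₁ (w j≡e) σ≤τ₀) (+-mono-≤ τ₀≤τ τ₀≤τ))
                      (solve 4 (λ σ τ τ₀ r → ((τ₀ ⊟ σ) ⊞ (τ ⊞ τ)) ⊟ (r ⊞ (τ₀ ⊞ τ₀)) ⊜ (τ ⊟ τ₀) ⊟ (r ⊟ (τ ⊟ σ))) ≈-refl σ τ τ₀ r))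
                  , (λ τ₀≤σ → ≤-shift (+-mono-≤ (proj₂ (w j≡e) τ₀≤σ) (+-mono-≤ σ≤τ σ≤τ))
                      (solve 4 (λ σ τ τ₀ r → ((σ ⊟ τ₀) ⊞ (τ ⊞ τ)) ⊟ (r ⊞ (σ ⊞ σ)) ⊜ (τ ⊟ τ₀) ⊟ (r ⊟ (τ ⊟ σ))) ≈-refl σ τ τ₀ r))
                  ]′ (total σ τ₀))

    module _ {h : V → Carrier} (feasible : Feasible to from cost h) where

      -- At an end of the edge carrying `x₀` the bound comes from the initial constraint there; the
      -- subtracted `0#` is the length of the gluing segment just passed.
      within-source : ∀ x {j τ r} → (∀ i → h (initialVertex x i) ≤ 0# + initialCost x i) →
                      τ ≈ 0# → r ≤ h (s j) → Within x j τ (r - 0#)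
      within-source (vertex _) h≤ τ≈0 r≤ = lift tt
      within-source (on _ τ₀ _ _) {j} {τ} {r} h≤ τ≈0 r≤ refl =
          (λ τ≤τ₀ → ≤-shift (+-mono-≤ r≤τ₀ (≤-reflexive τ≈0))
            (solve 3 (λ τ τ₀ r → ((𝟎 ⊞ τ₀) ⊞ 𝟎) ⊟ (r ⊞ τ) ⊜ (τ₀ ⊟ τ) ⊟ (r ⊟ 𝟎)) ≈-refl τ τ₀ r))
        , (λ τ₀≤τ → ≤-shift (+-mono-≤ r≤τ₀ (+-mono-≤ (+-mono-≤ τ₀≤τ τ₀≤τ) (≤-reflexive τ≈0)))
            (solve 3 (λ τ τ₀ r → ((𝟎 ⊞ τ₀) ⊞ ((τ ⊞ τ) ⊞ 𝟎)) ⊟ (r ⊞ ((τ₀ ⊞ τ₀) ⊞ τ)) ⊜ (τ ⊟ τ₀) ⊟ (r ⊟ 𝟎)) ≈-refl τ τ₀ r))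
        where
        r≤τ₀ : r ≤ 0# + τ₀
        r≤τ₀ = ≤-trans r≤ (h≤ zero)

      within-target : ∀ x {j τ r} → (∀ i → h (initialVertex x i) ≤ 0# + initialCost x i) →
                      τ ≈ l j → r ≤ h (t j) → Within x j τ (r - 0#)
      within-target (vertex _) h≤ τ≈l r≤ = lift tt
      within-target (on _ τ₀ _ _) {j} {τ} {r} h≤ τ≈l r≤ refl =
          (λ τ≤τ₀ → ≤-shift (+-mono-≤ r≤l-τ₀ (+-mono-≤ (+-mono-≤ τ≤τ₀ τ≤τ₀) l≤τ))
            (solve 4 (λ τ τ₀ r l → ((𝟎 ⊞ (l ⊟ τ₀)) ⊞ ((τ₀ ⊞ τ₀) ⊞ τ)) ⊟ (r ⊞ ((τ ⊞ τ) ⊞ l)) ⊜ (τ₀ ⊟ τ) ⊟ (r ⊟ 𝟎)) ≈-refl τ τ₀ r (l j)))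
        , (λ τ₀≤τ → ≤-shift (+-mono-≤ r≤l-τ₀ l≤τ)
            (solve 4 (λ τ τ₀ r l → ((𝟎 ⊞ (l ⊟ τ₀)) ⊞ τ) ⊟ (r ⊞ l) ⊜ (τ ⊟ τ₀) ⊟ (r ⊟ 𝟎)) ≈-refl τ τ₀ r (l j)))
        where
        r≤l-τ₀ : r ≤ 0# + (l j - τ₀)
        r≤l-τ₀ = ≤-trans r≤ (h≤ (suc zero))
        l≤τ : l j ≤ τ
        l≤τ = ≤-reflexive (≈-sym τ≈l)

      -- r is at most the distance from x₀ that h predicts for the point.
      Below : Point G → Carrier → Set a
      Below (vertex v)   r = r ≤ h v
      Below (on j τ _ _) r = r ≤ h (s j) + τ × r ≤ h (t j) + (l j - τ) × Within x₀ j τ r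

      below-mono : ∀ y {r r′} → r′ ≤ r → Below y r → Below y r′
      below-mono (vertex _)   r′≤r r≤ = ≤-trans r′≤r r≤
      below-mono (on _ _ _ _) r′≤r (r≤s , r≤t , w) =
        ≤-trans r′≤r r≤s , ≤-trans r′≤r r≤t , within-mono x₀ r′≤r w

      -- Feasibility makes predictions change at most as fast as length. Between a vertex and an
      -- interval glued to it, the estimate through the far end comes from the constraint along the
      -- whole edge.
      below-forth : ∀ {y z d r} → Joined G y z d → Below z r → Below y (r - d)
      below-forth {r = r} (along {e} {σ} {τ} _ _ _ _ σ≤τ) (r≤s , r≤t , w) =
          ≤-shift r≤s (solve 4 (λ σ τ h r → (h ⊞ τ) ⊟ r ⊜ (h ⊞ σ) ⊟ (r ⊟ (τ ⊟ σ))) ≈-refl σ τ (h (s e)) r)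
        , ≤-shift (+-mono-≤ r≤t (+-mono-≤ σ≤τ σ≤τ))
            (solve 5 (λ σ τ h l r → ((h ⊞ (l ⊟ τ)) ⊞ (τ ⊞ τ)) ⊟ (r ⊞ (σ ⊞ σ)) ⊜ (h ⊞ (l ⊟ σ)) ⊟ (r ⊟ (τ ⊟ σ))) ≈-refl
              σ τ (h (t e)) (l e) r)
        , within-forth x₀ σ≤τ w
      below-forth {r = r} (atSource {e} {τ} 0≤τ _ τ≈0) r≤ =
          ≤-shift (+-mono-≤ r≤ 0≤τ) (solve 3 (λ τ h r → (h ⊞ τ) ⊟ (r ⊞ 𝟎) ⊜ (h ⊞ τ) ⊟ (r ⊟ 𝟎)) ≈-refl τ (h (s e)) r)
        , ≤-shift (+-mono-≤ (≤-trans r≤ (feasible (backward e))) (≤-reflexive τ≈0))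
            (solve 4 (λ τ h l r → ((h ⊞ l) ⊞ 𝟎) ⊟ (r ⊞ τ) ⊜ (h ⊞ (l ⊟ τ)) ⊟ (r ⊟ 𝟎)) ≈-refl τ (h (t e)) (l e) r)
        , within-source x₀ (λ i → feasible (initial i)) τ≈0 r≤
      below-forth {r = r} (atTarget {e} {τ} _ τ≤l τ≈l) r≤ =
          ≤-shift (+-mono-≤ (≤-trans r≤ (feasible (forward e))) (≤-reflexive (≈-sym τ≈l)))
            (solve 4 (λ τ h l r → ((h ⊞ l) ⊞ τ) ⊟ (r ⊞ l) ⊜ (h ⊞ τ) ⊟ (r ⊟ 𝟎)) ≈-refl τ (h (s e)) (l e) r)
        , ≤-shift (+-mono-≤ r≤ τ≤l)
            (solve 4 (λ τ h l r → (h ⊞ l) ⊟ (r ⊞ τ) ⊜ (h ⊞ (l ⊟ τ)) ⊟ (r ⊟ 𝟎)) ≈-refl τ (h (t e)) (l e) r)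
        , within-target x₀ (λ i → feasible (initial i)) τ≈l r≤

      below-back : ∀ {y z d r} → Joined G y z d → Below y r → Below z (r - d)
      below-back {r = r} (along {e} {σ} {τ} _ _ _ _ σ≤τ) (r≤s , r≤t , w) =
          ≤-shift (+-mono-≤ r≤s (+-mono-≤ σ≤τ σ≤τ))
            (solve 4 (λ σ τ h r → ((h ⊞ σ) ⊞ (τ ⊞ τ)) ⊟ (r ⊞ (σ ⊞ σ)) ⊜ (h ⊞ τ) ⊟ (r ⊟ (τ ⊟ σ))) ≈-refl σ τ (h (s e)) r)
        , ≤-shift r≤t (solve 5 (λ σ τ h l r → (h ⊞ (l ⊟ σ)) ⊟ r ⊜ (h ⊞ (l ⊟ τ)) ⊟ (r ⊟ (τ ⊟ σ))) ≈-refl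
            σ τ (h (t e)) (l e) r)
        , within-back x₀ σ≤τ w
      below-back {r = r} (atSource {e} {τ} _ _ τ≈0) (r≤s , _) = ≤-shift (+-mono-≤ r≤s (≤-reflexive τ≈0))
        (solve 3 (λ τ h r → ((h ⊞ τ) ⊞ 𝟎) ⊟ (r ⊞ τ) ⊜ h ⊟ (r ⊟ 𝟎)) ≈-refl τ (h (s e)) r)
      below-back {r = r} (atTarget {e} {τ} _ _ τ≈l) (_ , r≤t , _) = ≤-shift (+-mono-≤ r≤t (≤-reflexive (≈-sym τ≈l)))
        (solve 4 (λ τ h l r → ((h ⊞ (l ⊟ τ)) ⊞ τ) ⊟ (r ⊞ l) ⊜ h ⊟ (r ⊟ 𝟎)) ≈-refl τ (h (t e)) (l e) r)

      below-path : ∀ {y z r} (p : Path G y z) → Below z r → Below y (r - pathLength G p)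
      below-path {y} {r = r} [] b = below-mono y (≤-reflexive (solve 1 (λ r → r ⊟ 𝟎 ⊜ r) ≈-refl r)) b
      below-path {y} {r = r} (_◅_ {d = d} step p) b = below-mono y
        (≤-reflexive (solve 3 (λ r d p → r ⊟ (d ⊞ p) ⊜ (r ⊟ p) ⊟ d) ≈-refl r d (pathLength G p)))
        ([ below-forth , below-back ]′ step (below-path p b))

      -- Weak duality: carried back along the path to `x₀`, the bound drops by the length travelled,
      -- and at `x₀` itself the prediction is at most zero. Thus every feasible function bounds all
      -- path lengths from below.
      lower-bound : ∀ {z r} (p : Path G x₀ z) → Below z r → r ≤ pathLength G p
      lower-bound {r = r} p b = ≤-shift (below-origin x₀ refl (below-path p b))
        (solve 2 (λ r p → 𝟎 ⊟ (r ⊟ p) ⊜ p ⊟ r) ≈-refl r (pathLength G p))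
        where
        below-origin : ∀ x {r} → x₀ ≡ x → Below x r → r ≤ 0#
        below-origin (vertex u) refl r≤ = ≤-trans r≤ (≤-trans (feasible (initial zero)) (≤-reflexive (+-identityˡ 0#)))
        below-origin (on e τ _ _) refl (_ , _ , w) =
          ≤-trans (proj₁ (w refl) ≤-refl) (≤-reflexive (-‿inverseʳ τ))

-- Shortest paths from the centre and the peaks of edges.

module Eccentricities {a : Level} (em : ExcludedMiddle a) (ℝ : RealNumbers a) where

  open Distances em ℝ public

  module _ {G : WeightedGraph} where

    infixr 5 _▻▻_

    _▻▻_ : ∀ {x y z} → Path G x y → Path G y z → Path G x z
    []         ▻▻ q = q
    (step ◅ p) ▻▻ q = step ◅ (p ▻▻ q)

    pathLength-▻▻ : ∀ {x y z} (p : Path G x y) (q : Path G y z) →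
                    pathLength G (p ▻▻ q) ≈ pathLength G p + pathLength G q
    pathLength-▻▻ []         q = ≈-sym (+-identityˡ _)
    pathLength-▻▻ (step ◅ p) q = ≈-trans (+-congˡ (pathLength-▻▻ p q)) (≈-sym (+-assoc _ _ _))

    PathOfLength : Point G → Point G → Carrier → Set a
    PathOfLength x y r = Σ[ p ∈ Path G x y ] pathLength G p ≈ r

    join : ∀ {x y z q r} → PathOfLength x y q → PathOfLength y z r → PathOfLength x z (q + r)
    join (p , p≈) (p′ , p′≈) = p ▻▻ p′ , ≈-trans (pathLength-▻▻ p p′) (+-cong p≈ p′≈)

    rename-length : ∀ {x y q r} → q ≈ r → PathOfLength x y q → PathOfLength x y r
    rename-length q≈r (p , p≈) = p , ≈-trans p≈ q≈r

    joined-nonneg : ∀ {x y d} → Joined G x y d → 0# ≤ d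
    joined-nonneg (along {s = σ} {t = τ} _ _ _ _ σ≤τ) = ≤-shift σ≤τ (solve 2 (λ σ τ → τ ⊟ σ ⊜ (τ ⊟ σ) ⊟ 𝟎) ≈-refl σ τ)
    joined-nonneg (atSource _ _ _) = ≤-refl
    joined-nonneg (atTarget _ _ _) = ≤-refl

    pathLength-nonneg : ∀ {x y} (p : Path G x y) → 0# ≤ pathLength G p
    pathLength-nonneg []         = ≤-refl
    pathLength-nonneg (step ◅ p) = ≤-trans (≤-reflexive (≈-sym (+-identityˡ 0#)))
      (+-mono-≤ ([ joined-nonneg , joined-nonneg ]′ step) (pathLength-nonneg p))

    Covered : Point G → Carrier → Set a
    Covered x R = ∀ {y d} → IsDistance G x y d → d ≤ R

    module _ {e : Fin (edgeCount G)} {τ : Carrier} (0≤τ : 0# ≤ τ) (τ≤l : τ ≤ len G e) where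

      private
        0≤l : 0# ≤ len G e
        0≤l = ≤-trans 0≤τ τ≤l

      toSource : PathOfLength (on e τ 0≤τ τ≤l) (vertex (source G e)) τ
      toSource = inj₂ (along ≤-refl 0≤l 0≤τ τ≤l 0≤τ) ◅ (inj₁ (atSource ≤-refl 0≤l ≈-refl) ◅ [])
        , solve 1 (λ τ → (τ ⊟ 𝟎) ⊞ (𝟎 ⊞ 𝟎) ⊜ τ) ≈-refl τ

      fromSource : PathOfLength (vertex (source G e)) (on e τ 0≤τ τ≤l) τ
      fromSource = inj₂ (atSource ≤-refl 0≤l ≈-refl) ◅ (inj₁ (along ≤-refl 0≤l 0≤τ τ≤l 0≤τ) ◅ [])
        , solve 1 (λ τ → 𝟎 ⊞ ((τ ⊟ 𝟎) ⊞ 𝟎) ⊜ τ) ≈-refl τ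

      toTarget : PathOfLength (on e τ 0≤τ τ≤l) (vertex (target G e)) (len G e - τ)
      toTarget = inj₁ (along 0≤τ τ≤l 0≤l ≤-refl τ≤l) ◅ (inj₁ (atTarget 0≤l ≤-refl ≈-refl) ◅ [])
        , solve 2 (λ τ l → (l ⊟ τ) ⊞ (𝟎 ⊞ 𝟎) ⊜ l ⊟ τ) ≈-refl τ (len G e)

    -- An end of an edge interval and the vertex glued to it are different values of `Point` at
    -- distance zero, so shortest paths from one extend to shortest paths from the other.
    covered-end : ∀ {x v R} → PathOfLength x (vertex v) 0# → PathOfLength (vertex v) x 0# →
                  Covered x R → Covered (vertex v) R
    covered-end there back covered (path , minimal) = covered
      ( rename-length (+-identityˡ _) (join there path)
      , λ d path′ → minimal d (rename-length (+-identityˡ _) (join back path′)) )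

  module Potentials-at (M : MetricGraph) (x₀ : Point (MetricGraph.graph M)) {R : Carrier}
                       (0≤R : 0# ≤ R) (covered : Covered {MetricGraph.graph M} x₀ R) where

    open FromPoint M x₀

    private
      s = source G
      t = target G
      l = len G

    initialPath : ∀ i → PathOfLength {G} x₀ (vertex (initialVertex x₀ i)) (initialCost x₀ i)
    initialPath = at x₀
      where
      at : ∀ x i → PathOfLength {G} x (vertex (initialVertex x i)) (initialCost x i)
      at (vertex u)         i       = [] , ≈-refl
      at (on e τ 0≤τ τ≤l) zero    = toSource 0≤τ τ≤l
      at (on e τ 0≤τ τ≤l) (suc _) = toTarget 0≤τ τ≤l

    initialCost-nonneg : ∀ i → 0# ≤ initialCost x₀ i
    initialCost-nonneg i = ≤-trans (pathLength-nonneg (proj₁ (initialPath i))) (≤-reflexive (proj₂ (initialPath i)))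

    cost-nonneg : ∀ i → 0# ≤ cost i
    cost-nonneg (forward e)  = proj₁ (0<l e)
    cost-nonneg (backward e) = proj₁ (0<l e)
    cost-nonneg (initial i)  = initialCost-nonneg i

    distances : ∃ λ f → Feasible to from cost f × (∀ v → 0# ≤ f v) × Tight to from cost f
    distances = greatest-feasible to from cost
      (boundedAway-⊎ (boundedAway-⊎ (boundedAway-Fin _) (boundedAway-Fin _)) (boundedAway-Fin 2))
      cost-nonneg
      -- A path from `x₀`, which exists by connectedness, bounds `h v` for all feasible `h` at once.
      (λ v → pathLength G (MetricGraph.connected M x₀ (vertex v))
           , λ h feasible → lower-bound feasible (MetricGraph.connected M x₀ (vertex v)) ≤-refl)

    module _ {f : Fin (vertexCount G) → Carrier} (feasible : Feasible to from cost f)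
             (0≤f : ∀ v → 0# ≤ f v) (tight : Tight to from cost f) where

      ⊏-wellFounded : WellFounded (λ v w → f v < f w)
      ⊏-wellFounded = spo-wellFounded {_≈_ = _≡_} (record
        { isEquivalence = ≡-isEquivalence
        ; irrefl        = λ { refl → <-irrefl ≈-refl }
        ; trans         = <-trans
        ; <-resp-≈      = (λ { refl v<w → v<w }) , λ { refl v<w → v<w }
        })

      longer : ∀ {x y} e → x ≈ y + l e → y < x
      longer {x} {y} e x≈ = <-≤-trans (<-shift (0<l e)
        (solve 2 (λ y l → l ⊟ 𝟎 ⊜ (y ⊞ l) ⊟ y) ≈-refl y (l e))) (≤-reflexive (≈-sym x≈))

      edgePath : ∀ e → PathOfLength {G} (vertex (s e)) (vertex (t e)) (l e)
      edgePath e = rename-length (solve 1 (λ l → l ⊞ (l ⊟ l) ⊜ l) ≈-refl (l e))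
        (join (fromSource (proj₁ (0<l e)) ≤-refl) (toTarget (proj₁ (0<l e)) ≤-refl))

      edgePath⁻ : ∀ e → PathOfLength {G} (vertex (t e)) (vertex (s e)) (l e)
      edgePath⁻ e = inj₂ (atTarget (proj₁ (0<l e)) ≤-refl ≈-refl) ◅ proj₁ back
        , ≈-trans (+-identityˡ _) (proj₂ back)
        where
        back = toSource (proj₁ (0<l e)) ≤-refl

      -- Tight constraints are followed backwards. Along an edge the height drops strictly, so on
      -- finitely many vertices the descent ends, necessarily at an initial constraint.
      shortest : ∀ v → PathOfLength {G} x₀ (vertex v) (f v)
      shortest v = go v (⊏-wellFounded v)
        where
        go : ∀ v → Acc (λ v w → f v < f w) v → PathOfLength {G} x₀ (vertex v) (f v)
        go v (acc rec) = by (tight v)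
          where
          by : (∃ λ i → to i ≡ v × f v ≈ value f (from i) + cost i) → PathOfLength {G} x₀ (vertex v) (f v)
          by (forward e , refl , eq)  = rename-length (≈-sym eq) (join (go (s e) (rec (longer e eq))) (edgePath e))
          by (backward e , refl , eq) = rename-length (≈-sym eq) (join (go (t e) (rec (longer e eq))) (edgePath⁻ e))
          by (initial i , refl , eq)  = rename-length (≈-sym (≈-trans eq (+-identityˡ _))) (initialPath i)

      -- A lower bound attained by a path is the distance, and `covered` applies to distances.
      below⇒≤R : ∀ {y r} → Below feasible y r → PathOfLength x₀ y r → r ≤ R
      below⇒≤R below path = covered (path ,
        λ { d (p , p≈d) → ≤-trans (lower-bound feasible p below) (≤-reflexive p≈d) })

      feasible-forward : ∀ e → f (t e) ≤ f (s e) + l e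
      feasible-forward e = feasible (forward e)

      feasible-backward : ∀ e → f (s e) ≤ f (t e) + l e
      feasible-backward e = feasible (backward e)

      -- The farthest point of an edge not containing x₀ is where the distances
      -- through the two ends agree.
      peak-≤R : ∀ e → (∀ {τ r} → Within x₀ e τ r) → (f (s e) + f (t e)) + l e ≤ R + R
      peak-≤R e within = from-half (halve ((f (t e) + l e) - f (s e)))
        where
        from-half : (∃ λ τ → τ + τ ≈ (f (t e) + l e) - f (s e)) → (f (s e) + f (t e)) + l e ≤ R + R
        from-half (τ , 2τ≈) = ≤-trans (≤-reflexive (≈-shift (≈-sym 2τ≈)
            (solve 4 (λ fs ft l τ → (τ ⊞ τ) ⊟ ((ft ⊞ l) ⊟ fs) ⊜ ((fs ⊞ τ) ⊞ (fs ⊞ τ)) ⊟ ((fs ⊞ ft) ⊞ l)) ≈-refl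
              (f (s e)) (f (t e)) (l e) τ)))
          (+-mono-≤ r≤R r≤R)
          where
          -- The constraints of the edge in its two directions are what places the point within the
          -- interval.
          0≤τ : 0# ≤ τ
          0≤τ = double-≤ (≤-trans (≤-shift (feasible-backward e)
            (solve 3 (λ fs ft l → (ft ⊞ l) ⊟ fs ⊜ ((ft ⊞ l) ⊟ fs) ⊟ (𝟎 ⊞ 𝟎)) ≈-refl (f (s e)) (f (t e)) (l e)))
            (≤-reflexive (≈-sym 2τ≈)))
          τ≤l : τ ≤ l e
          τ≤l = double-≤ (≤-trans (≤-reflexive 2τ≈) (≤-shift (feasible-forward e)
            (solve 3 (λ fs ft l → (fs ⊞ l) ⊟ ft ⊜ (l ⊞ l) ⊟ ((ft ⊞ l) ⊟ fs)) ≈-refl (f (s e)) (f (t e)) (l e))))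
          r≤R : f (s e) + τ ≤ R
          r≤R = below⇒≤R
            ( ≤-refl
            , ≤-shift (≤-reflexive 2τ≈)
                (solve 4 (λ fs ft l τ → ((ft ⊞ l) ⊟ fs) ⊟ (τ ⊞ τ) ⊜ (ft ⊞ (l ⊟ τ)) ⊟ (fs ⊞ τ)) ≈-refl
                  (f (s e)) (f (t e)) (l e) τ)
            , within )
            (join (shortest (s e)) (fromSource 0≤τ τ≤l))

  -- Potentials for a centre at a vertex or inside an edge.

  potential-vertex : ∀ (M : MetricGraph) u {R} → 0# ≤ R → Covered {MetricGraph.graph M} (vertex u) R →
                     Potential (MetricGraph.graph M) R
  potential-vertex M u {R} 0≤R covered = from-distances distances
    where
    open FromPoint M (vertex u)
    open Potentials-at M (vertex u) 0≤R covered
    from-distances : (∃ λ f → Feasible to from cost f × (∀ v → 0# ≤ f v) × Tight to from cost f) → Potential G R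
    from-distances (f , feasible , 0≤f , tight) = record
      { root          = u
      ; height        = f
      ; 0≤R           = 0≤R
      ; len-positive  = 0<l
      ; height-root   = ≤-antisym (≤-trans (feasible (initial zero)) (≤-reflexive (+-identityˡ 0#))) (0≤f u)
      ; height-nonneg = 0≤f
      ; parent        = λ v v≢u → parent v v≢u (tight v)
      ; peak-≤        = λ e → peak-≤R feasible 0≤f tight e (lift tt)
      }
      where
      parent : ∀ v → v ≢ u → (∃ λ i → to i ≡ v × f v ≈ value f (from i) + cost i) →
               ∃ λ e → ∃ λ w → Joins G e v w × f v ≈ f w + len G e
      parent v v≢u (forward e , t≡v , eq)  = e , source G e , inj₂ (refl , t≡v) , eq
      parent v v≢u (backward e , s≡v , eq) = e , target G e , inj₁ (s≡v , refl) , eq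
      parent v v≢u (initial _ , u≡v , _)   = contradiction (sym u≡v) v≢u

  -- The cut vertex becomes a root of height zero, and the two initial constraints become the two
  -- parts of `e₀`. All other tight constraints keep their edges.
  potential-split : ∀ (M : MetricGraph) e₀ {τ₀ R} (0≤τ₀ : 0# ≤ τ₀) (τ₀≤l : τ₀ ≤ len (MetricGraph.graph M) e₀) →
                    0# < τ₀ → τ₀ < len (MetricGraph.graph M) e₀ → 0# ≤ R →
                    Covered {MetricGraph.graph M} (on e₀ τ₀ 0≤τ₀ τ₀≤l) R →
                    Potential (split (MetricGraph.graph M) e₀ τ₀ (len (MetricGraph.graph M) e₀ - τ₀)) R
  potential-split M e₀ {τ₀} {R} 0≤τ₀ τ₀≤l 0<τ₀ τ₀<l 0≤R covered = from-distances distances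
    where
    open FromPoint M (on e₀ τ₀ 0≤τ₀ τ₀≤l)
    open Potentials-at M (on e₀ τ₀ 0≤τ₀ τ₀≤l) 0≤R covered

    l₀ : Carrier
    l₀ = len G e₀

    S : WeightedGraph
    S = split G e₀ τ₀ (l₀ - τ₀)

    cut : τ₀ + (l₀ - τ₀) ≈ l₀
    cut = solve 2 (λ τ l → τ ⊞ (l ⊟ τ) ⊜ l) ≈-refl τ₀ l₀

    from-distances : (∃ λ f → Feasible to from cost f × (∀ v → 0# ≤ f v) × Tight to from cost f) → Potential S R
    from-distances (f , feasible , 0≤f , tight) = record
      { root          = zero
      ; height        = h
      ; 0≤R           = 0≤R
      ; len-positive  = positive
      ; height-root   = ≈-refl
      ; height-nonneg = λ { zero → ≤-refl ; (suc v) → 0≤f v }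
      ; parent        = λ { zero 0≢0 → contradiction refl 0≢0 ; (suc v) _ → parent v (tight v) }
      ; peak-≤        = peaks
      }
      where
      h : Fin (vertexCount S) → Carrier
      h zero    = 0#
      h (suc v) = f v

      fs ft : Carrier
      fs = f (source G e₀)
      ft = f (target G e₀)

      fs≤τ₀ : fs ≤ 0# + τ₀
      fs≤τ₀ = feasible (initial zero)

      ft≤l₀-τ₀ : ft ≤ 0# + (l₀ - τ₀)
      ft≤l₀-τ₀ = feasible (initial (suc zero))

      positive : ∀ j → 0# < len S j
      positive zero    = <-shift τ₀<l (solve 2 (λ τ l → l ⊟ τ ⊜ (l ⊟ τ) ⊟ 𝟎) ≈-refl τ₀ l₀)
      positive (suc j) = by (j ≟ᶠ e₀)
        where
        by : Dec (j ≡ e₀) → 0# < len S (suc j)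
        by (yes refl) = <-≤-trans 0<τ₀ (≤-reflexive (≈-reflexive (sym (split-len G e₀ cut))))
        by (no j≢e₀)  = <-≤-trans (0<l j) (≤-reflexive (≈-reflexive (sym (split-len-≢ G e₀ cut j≢e₀))))

      ParentOf : Fin (vertexCount G) → Set a
      ParentOf v = ∃ λ k → ∃ λ w → Joins S k (suc v) w × f v ≈ h w + len S k

      parent : ∀ v → (∃ λ i → to i ≡ v × f v ≈ value f (from i) + cost i) → ParentOf v
      parent v (initial zero , refl , eq) = suc e₀ , zero , inj₁ (refl , split-target G e₀ cut)
        , ≈-trans eq (+-congˡ (≈-reflexive (sym (split-len G e₀ cut))))
      parent v (initial (suc zero) , refl , eq) = zero , zero , inj₂ (refl , refl) , eq
      parent v (forward j , refl , eq) = by (j ≟ᶠ e₀)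
        where
        by : Dec (j ≡ e₀) → ParentOf (target G j)
        by (no j≢e₀) = suc j , suc (source G j) , inj₂ (refl , split-target-≢ G e₀ cut j≢e₀)
          , ≈-trans eq (+-congˡ (≈-reflexive (sym (split-len-≢ G e₀ cut j≢e₀))))
        -- A tight constraint along all of `e₀` would put its target at height at least `l₀`, though
        -- the cut vertex is only `l₀ - τ₀` away from it.
        by (yes refl) = contradiction 0<τ₀ (≤⇒≯ (≤-shift
          (+-mono-≤ (+-mono-≤ ft≤l₀-τ₀ (≤-reflexive (≈-sym eq))) (0≤f (source G e₀)))
          (solve 4 (λ fs ft τ l → (((𝟎 ⊞ (l ⊟ τ)) ⊞ ft) ⊞ fs) ⊟ ((ft ⊞ (fs ⊞ l)) ⊞ 𝟎) ⊜ 𝟎 ⊟ τ) ≈-refl fs ft τ₀ l₀)))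
      parent v (backward j , refl , eq) = by (j ≟ᶠ e₀)
        where
        by : Dec (j ≡ e₀) → ParentOf (source G j)
        by (no j≢e₀) = suc j , suc (target G j) , inj₁ (refl , split-target-≢ G e₀ cut j≢e₀)
          , ≈-trans eq (+-congˡ (≈-reflexive (sym (split-len-≢ G e₀ cut j≢e₀))))
        by (yes refl) = contradiction τ₀<l (≤⇒≯ (≤-shift
          (+-mono-≤ (+-mono-≤ fs≤τ₀ (≤-reflexive (≈-sym eq))) (0≤f (target G e₀)))
          (solve 4 (λ fs ft τ l → (((𝟎 ⊞ τ) ⊞ fs) ⊞ ft) ⊟ ((fs ⊞ (ft ⊞ l)) ⊞ 𝟎) ⊜ τ ⊟ l) ≈-refl fs ft τ₀ l₀)))

      -- The farthest point between the source and the cut vertex is where the direct distance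
      -- `τ₀ - τ` equals the distance `fs + τ` through the source, that is, `τ + τ ≈ τ₀ - fs`.
      source-part : (fs + 0#) + τ₀ ≤ R + R
      source-part = from-half (halve (τ₀ - fs))
        where
        from-half : (∃ λ τ → τ + τ ≈ τ₀ - fs) → (fs + 0#) + τ₀ ≤ R + R
        from-half (τ , 2τ≈) = ≤-trans (≤-reflexive (≈-shift 2τ≈
            (solve 3 (λ fs τ τ₀ → (τ₀ ⊟ fs) ⊟ (τ ⊞ τ) ⊜ ((τ₀ ⊟ τ) ⊞ (τ₀ ⊟ τ)) ⊟ ((fs ⊞ 𝟎) ⊞ τ₀)) ≈-refl fs τ τ₀)))
          (+-mono-≤ r≤R r≤R)
          where
          0≤τ : 0# ≤ τ
          0≤τ = double-≤ (≤-trans (≤-shift fs≤τ₀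
            (solve 2 (λ fs τ₀ → (𝟎 ⊞ τ₀) ⊟ fs ⊜ (τ₀ ⊟ fs) ⊟ (𝟎 ⊞ 𝟎)) ≈-refl fs τ₀)) (≤-reflexive (≈-sym 2τ≈)))
          τ≤τ₀ : τ ≤ τ₀
          τ≤τ₀ = double-≤ (≤-trans (≤-reflexive 2τ≈) (≤-shift (+-mono-≤ (0≤f (source G e₀)) 0≤τ₀)
            (solve 2 (λ fs τ₀ → (fs ⊞ τ₀) ⊟ (𝟎 ⊞ 𝟎) ⊜ (τ₀ ⊞ τ₀) ⊟ (τ₀ ⊟ fs)) ≈-refl fs τ₀)))
          r≤R : τ₀ - τ ≤ R
          r≤R = below⇒≤R feasible 0≤f tight {on e₀ τ 0≤τ (≤-trans τ≤τ₀ τ₀≤l)}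
            ( ≤-shift (≤-reflexive (≈-sym 2τ≈))
                (solve 3 (λ fs τ τ₀ → (τ ⊞ τ) ⊟ (τ₀ ⊟ fs) ⊜ (fs ⊞ τ) ⊟ (τ₀ ⊟ τ)) ≈-refl fs τ τ₀)
            , ≤-shift (+-mono-≤ (0≤f (target G e₀)) τ₀≤l)
                (solve 4 (λ ft τ τ₀ l → (ft ⊞ l) ⊟ (𝟎 ⊞ τ₀) ⊜ (ft ⊞ (l ⊟ τ)) ⊟ (τ₀ ⊟ τ)) ≈-refl ft τ τ₀ l₀)
            , λ _ → (λ _ → ≤-refl)
                  , λ τ₀≤τ → ≤-shift (+-mono-≤ τ₀≤τ τ₀≤τ)
                      (solve 2 (λ τ τ₀ → (τ ⊞ τ) ⊟ (τ₀ ⊞ τ₀) ⊜ (τ ⊟ τ₀) ⊟ (τ₀ ⊟ τ)) ≈-refl τ τ₀) )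
            (inj₂ (along 0≤τ (≤-trans τ≤τ₀ τ₀≤l) 0≤τ₀ τ₀≤l τ≤τ₀) ◅ [] , +-identityʳ _)

      -- Here the direct distance `τ - τ₀` and the distance `ft + (l₀ - τ)` through the target
      -- balance, which determines `τ`.
      target-part : (0# + ft) + (l₀ - τ₀) ≤ R + R
      target-part = from-half (halve ((ft + l₀) + τ₀))
        where
        from-half : (∃ λ τ → τ + τ ≈ (ft + l₀) + τ₀) → (0# + ft) + (l₀ - τ₀) ≤ R + R
        from-half (τ , 2τ≈) = ≤-trans (≤-reflexive (≈-shift (≈-sym 2τ≈)
            (solve 4 (λ ft τ τ₀ l → (τ ⊞ τ) ⊟ ((ft ⊞ l) ⊞ τ₀) ⊜ ((τ ⊟ τ₀) ⊞ (τ ⊟ τ₀)) ⊟ ((𝟎 ⊞ ft) ⊞ (l ⊟ τ₀))) ≈-refl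
              ft τ τ₀ l₀)))
          (+-mono-≤ r≤R r≤R)
          where
          τ₀≤τ : τ₀ ≤ τ
          τ₀≤τ = double-≤ (≤-trans (≤-shift (+-mono-≤ (0≤f (target G e₀)) τ₀≤l)
            (solve 3 (λ ft τ₀ l → (ft ⊞ l) ⊟ (𝟎 ⊞ τ₀) ⊜ ((ft ⊞ l) ⊞ τ₀) ⊟ (τ₀ ⊞ τ₀)) ≈-refl ft τ₀ l₀))
            (≤-reflexive (≈-sym 2τ≈)))
          τ≤l : τ ≤ l₀
          τ≤l = double-≤ (≤-trans (≤-reflexive 2τ≈) (≤-shift ft≤l₀-τ₀
            (solve 3 (λ ft τ₀ l → (𝟎 ⊞ (l ⊟ τ₀)) ⊟ ft ⊜ (l ⊞ l) ⊟ ((ft ⊞ l) ⊞ τ₀)) ≈-refl ft τ₀ l₀)))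
          r≤R : τ - τ₀ ≤ R
          r≤R = below⇒≤R feasible 0≤f tight {on e₀ τ (≤-trans 0≤τ₀ τ₀≤τ) τ≤l}
            ( ≤-shift (+-mono-≤ (0≤f (source G e₀)) 0≤τ₀)
                (solve 3 (λ fs τ τ₀ → (fs ⊞ τ₀) ⊟ (𝟎 ⊞ 𝟎) ⊜ (fs ⊞ τ) ⊟ (τ ⊟ τ₀)) ≈-refl fs τ τ₀)
            , ≤-shift (≤-reflexive 2τ≈)
                (solve 4 (λ ft τ τ₀ l → ((ft ⊞ l) ⊞ τ₀) ⊟ (τ ⊞ τ) ⊜ (ft ⊞ (l ⊟ τ)) ⊟ (τ ⊟ τ₀)) ≈-refl ft τ τ₀ l₀)
            , λ _ → (λ τ≤τ₀ → ≤-shift (+-mono-≤ τ≤τ₀ τ≤τ₀)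
                      (solve 2 (λ τ τ₀ → (τ₀ ⊞ τ₀) ⊟ (τ ⊞ τ) ⊜ (τ₀ ⊟ τ) ⊟ (τ ⊟ τ₀)) ≈-refl τ τ₀))
                  , λ _ → ≤-refl )
            (inj₁ (along 0≤τ₀ τ₀≤l (≤-trans 0≤τ₀ τ₀≤τ) τ≤l τ₀≤τ) ◅ [] , +-identityʳ _)

      peaks : ∀ j → (h (source S j) + h (target S j)) + len S j ≤ R + R
      peaks zero    = target-part
      peaks (suc j) = by (j ≟ᶠ e₀)
        where
        by : Dec (j ≡ e₀) → (h (source S (suc j)) + h (target S (suc j))) + len S (suc j) ≤ R + R
        by (yes refl) = ≤-trans (≤-reflexive (+-cong
          (+-congˡ (≈-reflexive (cong h (split-target G e₀ cut)))) (≈-reflexive (split-len G e₀ cut)))) source-part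
        by (no j≢e₀) = ≤-trans (≤-reflexive (+-cong
          (+-congˡ (≈-reflexive (cong h (split-target-≢ G e₀ cut j≢e₀)))) (≈-reflexive (split-len-≢ G e₀ cut j≢e₀))))
          (peak-≤R feasible 0≤f tight j λ j≡e₀ → contradiction j≡e₀ j≢e₀)

  -- The two implications.

  radius⇒star : ∀ (M : MetricGraph) {R} → let G = MetricGraph.graph M in
                IsRadius G R → totalLength G ≈ (2 ℕ.* cyc G ℕ.+ leafCount G) · R → IsStar G R
  radius⇒star M {R} ((x₀ , (y₀ , (p₀ , p₀≈R) , _) , upper) , _) extremal = at x₀ λ distance → upper _ (_ , distance)
    where
    G = MetricGraph.graph M
    -- `R` is the length of a path from the centre to a farthest point.
    0≤R : 0# ≤ R
    0≤R = ≤-trans (pathLength-nonneg p₀) (≤-reflexive p₀≈R)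
    at-vertex : ∀ u → Covered (vertex u) R → IsStar G R
    at-vertex u covered = extremal⇒star (potential-vertex M u 0≤R covered) extremal
    at : ∀ x → Covered x R → IsStar G R
    at (vertex u) covered = at-vertex u covered
    -- A centre at an end of the interval is moved to the glued vertex, since cutting there would
    -- leave a part of length zero.
    at (on e τ 0≤τ τ≤l) covered = [ at-start , (λ 0<τ → [ at-end , inside 0<τ ]′ (≤-decided τ≤l)) ]′ (≤-decided 0≤τ)
      where
      at-start : 0# ≈ τ → IsStar G R
      at-start 0≈τ = at-vertex (source G e) (covered-end {G}
        (inj₁ (atSource 0≤τ τ≤l (≈-sym 0≈τ)) ◅ [] , +-identityˡ 0#)
        (inj₂ (atSource 0≤τ τ≤l (≈-sym 0≈τ)) ◅ [] , +-identityˡ 0#) covered)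
      at-end : τ ≈ len G e → IsStar G R
      at-end τ≈l = at-vertex (target G e) (covered-end {G}
        (inj₁ (atTarget 0≤τ τ≤l τ≈l) ◅ [] , +-identityˡ 0#)
        (inj₂ (atTarget 0≤τ τ≤l τ≈l) ◅ [] , +-identityˡ 0#) covered)
      inside : 0# < τ → τ < len G e → IsStar G R
      inside 0<τ τ<l =
          -- The cyclomatic number of `S` computes to that of `G`, so only the leaf count is
          -- transported.
          fwd (subdivide e τ c 0<τ 0<c cut) Star.◅ subst (λ k → S ∼ star k (cyc G) R) same-leaves (proj₁ S-star)
        , subst (λ k → ¬ IsLeaf (star k (cyc G) R) zero) same-leaves (proj₂ S-star)
        where
        c : Carrier
        c = len G e - τ
        S : WeightedGraph
        S = split G e τ c
        0<c : 0# < c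
        0<c = <-shift τ<l (solve 2 (λ τ l → l ⊟ τ ⊜ (l ⊟ τ) ⊟ 𝟎) ≈-refl τ (len G e))
        cut : τ + c ≈ len G e
        cut = solve 2 (λ τ l → τ ⊞ (l ⊟ τ) ⊜ l) ≈-refl τ (len G e)
        same-leaves : leafCount S ≡ leafCount G
        same-leaves = leafCount-split G e τ c
        S-star : IsStar S R
        S-star = extremal⇒star (potential-split M e 0≤τ τ≤l 0<τ τ<l 0≤R covered)
          (≈-trans (totalLength-split G e τ c cut)
            (≈-trans extremal (×-congˡ (cong (λ k → 2 ℕ.* cyc G ℕ.+ k) (sym same-leaves)))))

  star⇒extremal : ∀ {G R} → IsStar G R → totalLength G ≈ (2 ℕ.* cyc G ℕ.+ leafCount G) · R
  star⇒extremal {G} {R} (G∼star , _) = ≈-trans (totalLength-∼ G∼star) (totalLength-star (leafCount G) (cyc G) R)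

mainTheorem2 : {a : Level} → ExcludedMiddle a → (ℝ : RealNumbers a) →
    let open RealNumbers ℝ
        open MetricGraphs ℝ
        open MetricGraph in
    (G : MetricGraph) (R : Carrier) → IsRadius G R →
    (totalLength G ≈ (2 ℕ.* cyc G ℕ.+ leafCount G) · R) ⇔ IsStar (graph G) R
mainTheorem2 em ℝ G R radius = mk⇔ (radius⇒star G radius) star⇒extremal
  where open Eccentricities em ℝ
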